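{- Let $k,n$ be integers with $0\le k\le (n-4)/3$. Let $G=(G_1,\ldots,G_n)$ be a collection of $n$ graphs on a common vertex set $V$ with $|V|=n$, such that $\sigma_2(G_i)\ge n+k$ for all $i\in[n]$. Let $H$ be a linear forest with $k$ edges and $V(H)\subseteq V$, together with an injection $c:E(H)\to[n]$ with $e\in E(G_{c(e)})$ for all $e\in E(H)$ (so $H$ is a rainbow linear forest in $G$); write $c(H)=\{c(e):e\in E(H)\}$. Let $u,v\in V$ be an $H$-compatible pair of vertices. Then at least one of the following holds: (C1) there exists a Hamiltonian path $P$ in the complete graph on $V$ with endpoints $u$ and $v$ that contains $H$ as a subgraph, together with an injection $c':E(P)\to[n]$ extending $c$ such that $e\in E(G_{c'(e)})$ for every $e\in E(P)$ (i.e., a rainbow Hamiltonian $u,v$-path containing $H$); (C2) $H$ has exactly two components, namely $H_u$ and $H_v$, and there exists a partition $X\cup Y$ of $V\setminus V(H)$ with $|X|,|Y|\ge 1$ such that for every color $i\in[n]\setminus c(H)$: in $G_i$, $X$ and $Y$ induce cliques, there are no edges between $X$ and $Y$, and every vertex of $V(H)$ is adjacent to every vertex of $X\cup Y$; (C3) there is a partition $V=X\cup Y$ with $|X|=(n+k)/2$ and $|Y|=(n-k)/2$ such that $V(H)\subseteq X$, and for every $i\in[n]\setminus c(H)$, $G_i[X,Y]$ is complete bipartite and $Y$ is an independent set in $G_i$.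
   Context: For a graph $F$, $\sigma_2(F)=\min\{d_F(x)+d_F(y): x\ne y,\ xy\notin E(F)\}$. A linear forest is a forest every component of which is a path. Given a linear forest $H$, a pair of vertices $u,v$ is $H$-compatible if $d_H(u)\le 1$, $d_H(v)\le 1$, and $u$ and $v$ belong to different components of $H$. Convention: $H$ is regarded as containing $u$ and $v$ (as isolated vertices if they are not incident to edges of $H$), so $V(H)$ is the set of vertices incident to edges of $H$ together with $u$ and $v$; $H_u$ and $H_v$ denote the (distinct) components of $H$ containing $u$ and $v$ respectively, each having $u$, resp. $v$, as an endpoint (possibly a single vertex). $G_i[X,Y]$ denotes the bipartite subgraph of $G_i$ formed by the edges between $X$ and $Y$. -}

module Defs where

open import Data.Nat using (ℕ; zero; suc; _+_; _*_; _∸_; _≤_; _<_)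
open import Data.Fin using (Fin; toℕ; _<_)
open import Data.Fin.Subset using (Subset; ∣_∣; _∈_; _∉_)
open import Data.Bool using (Bool; true; false; _∧_)
open import Data.Vec using (tabulate)
open import Data.List using (List; []; _∷_; _++_; [_]; length; map; allFin)
open import Data.Nat.ListAction using (sum)
open import Data.List.Relation.Unary.Unique.Propositional using (Unique)
open import Data.Product using (Σ; ∃; ∃-syntax; _×_; _,_)
open import Data.Sum using (_⊎_)
open import Data.Unit using (⊤)
open import Data.Empty using (⊥)
open import Relation.Nullary using (¬_)
open import Relation.Nullary.Decidable using (⌊_⌋)
open import Relation.Binary.PropositionalEquality using (_≡_; _≢_)
open import Relation.Binary.Construct.Closure.ReflexiveTransitive using (Star)
import Data.Fin as F

record Graph (n : ℕ) : Set where
  field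
    adj     : Fin n → Fin n → Bool
    sym     : ∀ x y → adj x y ≡ adj y x
    irrefl  : ∀ x → adj x x ≡ false
open Graph public

Adj : ∀ {n} → Graph n → Fin n → Fin n → Set
Adj F x y = adj F x y ≡ true

nbhd : ∀ {n} → Graph n → Fin n → Subset n
nbhd F x = tabulate (adj F x)

deg : ∀ {n} → Graph n → Fin n → ℕ
deg F x = ∣ nbhd F x ∣

-- σ₂(F) ≥ m  (with σ₂ of a complete graph being +∞, i.e. the condition is vacuous)
σ₂≥ : ∀ {n} → Graph n → ℕ → Set
σ₂≥ F m = ∀ x y → x ≢ y → ¬ Adj F x y → m ≤ deg F x + deg F y

numEdges : ∀ {n} → Graph n → ℕ
numEdges {n} F =
  sum (map (λ x → ∣ tabulate (λ y → ⌊ x F.<? y ⌋ ∧ adj F x y) ∣) (allFin n))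

Linked : ∀ {n} → Graph n → List (Fin n) → Set
Linked F [] = ⊤
Linked F (x ∷ []) = ⊤
Linked F (x ∷ y ∷ xs) = Adj F x y × Linked F (y ∷ xs)

HasCycle : ∀ {n} → Graph n → Set
HasCycle F = ∃[ x ] ∃[ xs ] (Unique (x ∷ xs) × 2 ≤ length xs × Linked F (x ∷ xs ++ [ x ]))

IsLinearForest : ∀ {n} → Graph n → Set
IsLinearForest H = ¬ HasCycle H × (∀ x → deg H x ≤ 2)

Connected : ∀ {n} → Graph n → Fin n → Fin n → Set
Connected H = Star (Adj H)

Compatible : ∀ {n} → Graph n → Fin n → Fin n → Set
Compatible H u v = deg H u ≤ 1 × deg H v ≤ 1 × ¬ Connected H u v

InVH : ∀ {n} → Graph n → Fin n → Fin n → Fin n → Set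
InVH H u v w = (∃[ y ] Adj H w y) ⊎ w ≡ u ⊎ w ≡ v

SameEdge : ∀ {n} → Fin n → Fin n → Fin n → Fin n → Set
SameEdge a b a' b' = (a ≡ a' × b ≡ b') ⊎ (a ≡ b' × b ≡ a')

record RainbowColouring {n : ℕ} (G : Fin n → Graph n) (H : Graph n) : Set where
  field
    col     : Fin n → Fin n → Fin n
    col-sym : ∀ a b → Adj H a b → col a b ≡ col b a
    col-ok  : ∀ a b → Adj H a b → Adj (G (col a b)) a b
    col-inj : ∀ a b a' b' → Adj H a b → Adj H a' b' → col a b ≡ col a' b' → SameEdge a b a' b'
open RainbowColouring public

InCH : ∀ {n} {G : Fin n → Graph n} {H : Graph n} → RainbowColouring G H → Fin n → Set
InCH {H = H} c i = ∃[ a ] ∃[ b ] (Adj H a b × col c a b ≡ i)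

Next : ∀ {n} → Fin n → Fin n → Set
Next i j = toℕ j ≡ suc (toℕ i)

-- (C1): a rainbow Hamiltonian u,v-path containing H, whose colouring extends c.
-- The path visits the vertices p 0, p 1, …, p (n-1) in order; its edges are
-- {p i, p (i+1)}, coloured c' i.
record RainbowHamPath {n : ℕ} (G : Fin n → Graph n) (H : Graph n)
                      (c : RainbowColouring G H) (u v : Fin n) : Set where
  field
    p        : Fin n → Fin n
    p-inj    : ∀ i j → p i ≡ p j → i ≡ j
    p-start  : ∀ i → toℕ i ≡ 0 → p i ≡ u
    p-end    : ∀ i → toℕ i ≡ n ∸ 1 → p i ≡ v
    contains : ∀ a b → Adj H a b → ∃[ i ] ∃[ j ] (Next i j × SameEdge a b (p i) (p j))
    c'       : Fin n → Fin n
    c'-ok    : ∀ i j → Next i j → Adj (G (c' i)) (p i) (p j)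
    c'-inj   : ∀ i j i' j' → Next i j → Next i' j' → c' i ≡ c' i' → i ≡ i'
    c'-ext   : ∀ i j → Next i j → Adj H (p i) (p j) → c' i ≡ col c (p i) (p j)
open RainbowHamPath public

C2 : ∀ {n} (G : Fin n → Graph n) (H : Graph n) (c : RainbowColouring G H) (u v : Fin n) → Set
C2 {n} G H c u v =
  (∀ w → InVH H u v w → Connected H u w ⊎ Connected H v w)
  × Σ (Subset n) λ X →
      (∃[ x ] (¬ InVH H u v x × x ∈ X))
    × (∃[ y ] (¬ InVH H u v y × y ∉ X))
    × (∀ i → ¬ InCH c i →
          (∀ x x' → ¬ InVH H u v x → ¬ InVH H u v x' → x ∈ X → x' ∈ X → x ≢ x' → Adj (G i) x x')
        × (∀ y y' → ¬ InVH H u v y → ¬ InVH H u v y' → y ∉ X → y' ∉ X → y ≢ y' → Adj (G i) y y')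
        × (∀ x y → ¬ InVH H u v x → ¬ InVH H u v y → x ∈ X → y ∉ X → ¬ Adj (G i) x y)
        × (∀ w z → InVH H u v w → ¬ InVH H u v z → Adj (G i) w z))

C3 : ∀ {n} (G : Fin n → Graph n) (H : Graph n) (c : RainbowColouring G H) (u v : Fin n) (k : ℕ) → Set
C3 {n} G H c u v k =
  Σ (Subset n) λ X →
      2 * ∣ X ∣ ≡ n + k
    × 2 * (n ∸ ∣ X ∣) ≡ n ∸ k
    × (∀ w → InVH H u v w → w ∈ X)
    × (∀ i → ¬ InCH c i →
          (∀ x y → x ∈ X → y ∉ X → Adj (G i) x y)
        × (∀ y y' → y ∉ X → y' ∉ X → ¬ Adj (G i) y y'))

{-# OPTIONS --safe #-}
-- Closing the path by the edge uv turns the problem into finding a spanning rainbow cycle through a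
-- linear forest with k + 1 edges, where one colour more than needed is available.  If a cycle fails to
-- exist only because of one bad edge, delete that edge: a spanning path from x to y remains, with two
-- spare colours i and s.  Whenever a free step a-b of it has x ~ b and y ~ a in the two spare colours, the
-- cycle closes up.  Hence d_i(x) + d_s(y) and d_s(x) + d_i(y) are both at most n + k, while by the degree
-- condition their sum is at least 2(n + k); so there is equality at every step of the path.  Comparing
-- these equalities for the path and for its rotations shows that either x and y have the same
-- neighbours, which gives (C3), or the path splits into a clique at x, the forest, and a clique at y,
-- which gives (C2).  To arrive at such a path, start from complete graphs in all free colours and put
-- back the given graphs one colour at a time.
module Submission where

open import Defs hiding (sym)
open import Axiom.UniquenessOfIdentityProofs.WithK using (uip)
open import Data.Bool using (Bool; true; false; not; if_then_else_; _∧_; _∨_)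
import Data.Bool as Bool
open import Data.Bool.Properties using (∨-comm; not-injective)
open import Data.Empty using (⊥; ⊥-elim)
open import Data.Fin using (Fin; zero; suc; toℕ)
import Data.Fin as Fin
import Data.Fin.Properties as FinP
open import Data.Fin.Subset using (∣_∣)
import Data.Fin.Subset as Sub
open import Data.List using (List; []; _∷_; _++_; [_]; map; length; allFin; concatMap)
import Data.List as List
import Data.List.Membership.DecPropositional as DecMembership
open import Data.List.Membership.Propositional using (_∈_; _∉_)
open import Data.List.Membership.Propositional.Properties
  using (∈-++⁺ˡ; ∈-++⁺ʳ; ∈-++⁻; ∈-map⁺; ∈-map⁻; ∈-allFin; ∈-∃++)
open import Data.List.Properties
  using (map-++; map-∘; map-tabulate; length-++; length-map; length-tabulate; ++-assoc; ++-identityʳ; concatMap-map; concatMap-pure)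
open import Data.List.Relation.Binary.Permutation.Propositional
  using (_↭_; ↭-refl; ↭-sym; ↭-trans; ↭-reflexive; prep; module PermutationReasoning)
import Data.List.Relation.Binary.Permutation.Propositional as Perm
import Data.List.Relation.Binary.Permutation.Propositional.Properties as PermP
import Data.List.Relation.Binary.Permutation.Setoid.Properties as PermSetoid
import Data.List.Relation.Unary.All as All
open import Data.List.Relation.Unary.AllPairs using ([]; _∷_)
open All using ([]; _∷_)
open import Data.List.Relation.Unary.Any using (here; there)
open import Data.List.Relation.Unary.Unique.Propositional using (Unique)
open import Data.List.Relation.Unary.Unique.Propositional.Properties using (allFin⁺; Unique[x∷xs]⇒x∉xs)
open import Data.Nat using (ℕ; zero; suc; _+_; _*_; _∸_; _≤_; _<_; z≤n; s≤s; pred)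
open import Data.Nat.ListAction using (sum)
open import Data.Nat.ListAction.Properties using (sum-++; sum-↭)
open import Data.Nat.Properties
open import Data.Nat.Solver using (module +-*-Solver)
open import Data.Product using (Σ; ∃-syntax; _×_; _,_; proj₁; proj₂)
open import Data.Sum using (_⊎_; inj₁; inj₂)
open import Data.Vec using (tabulate)
open import Data.Vec.Properties using (lookup∘tabulate; []=⇒lookup; lookup⇒[]=)
open import Function using (_∘_; id)
open import Relation.Binary using (DecidableEquality)
open import Relation.Binary.Construct.Closure.ReflexiveTransitive using (ε; _◅_)
open import Relation.Binary.Definitions using (tri<; tri≈; tri>)
open import Relation.Binary.PropositionalEquality
  using (_≡_; _≢_; refl; sym; trans; cong; cong₂; subst; module ≡-Reasoning; setoid)
open import Relation.Nullary using (¬_; Dec; yes; no)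
open import Relation.Nullary.Decidable using (⌊_⌋; _×-dec_; map′)

-- The constant n + k in the degree bound is a budget over the steps of the path. A spanning path
-- has n - 1 steps. A free step can carry one of the two crossing adjacencies; a fixed step cannot
-- be given up in a rotation, so it may carry both. With at most k + 1 fixed labels (the colours of
-- H and the edge uv) the budget is at most n + k, which is the amount that the degree condition
-- supplies. The conclusions concern every free colour, whereas a path only gives access to its two
-- spare ones. Equality makes the spare labels agree on the neighbours of each end, and a rotation
-- exchanges a spare label for one on the path, so facts pass from label to label. Only missing
-- edges can be brought back to the given graphs this way, because at an intermediate stage the free
-- labels carry supergraphs of them. The edges required by (C2) and (C3) are therefore recovered by
-- a second tight count, made with the degree condition of each G_i itself. A fixed label carries
-- the graph of a single edge. A spanning path whose spare labels are free thus contains H and uv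
-- automatically.

-- Indicator sums, Booleans and lists

𝟙 : Bool → ℕ
𝟙 b = if b then 1 else 0

𝟙≤1 : ∀ b → 𝟙 b ≤ 1
𝟙≤1 true  = ≤-refl
𝟙≤1 false = z≤n

module _ {A : Set} where

  sum-map-+ : (f g : A → ℕ) (xs : List A) →
    sum (map (λ x → f x + g x) xs) ≡ sum (map f xs) + sum (map g xs)
  sum-map-+ f g []       = refl
  sum-map-+ f g (x ∷ xs) rewrite sum-map-+ f g xs =
    trans (+-assoc (f x) (g x) _)
      (trans (cong (f x +_) (trans (sym (+-assoc (g x) F G)) (trans (cong (_+ G) (+-comm (g x) F)) (+-assoc F (g x) G))))
        (sym (+-assoc (f x) F (g x + G))))
    where F = sum (map f xs)
          G = sum (map g xs)

  sum-map-cong : {f g : A → ℕ} (xs : List A) → (∀ {x} → x ∈ xs → f x ≡ g x) →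
    sum (map f xs) ≡ sum (map g xs)
  sum-map-cong []       eq = refl
  sum-map-cong (x ∷ xs) eq = cong₂ _+_ (eq (here refl)) (sum-map-cong xs (eq ∘ there))

  sum-map-const : (c : ℕ) (xs : List A) → sum (map (λ _ → c) xs) ≡ length xs * c
  sum-map-const c []       = refl
  sum-map-const c (x ∷ xs) = cong (c +_) (sum-map-const c xs)

  sum-map-mono : {f g : A → ℕ} (xs : List A) → (∀ {x} → x ∈ xs → f x ≤ g x) →
    sum (map f xs) ≤ sum (map g xs)
  sum-map-mono []       le = z≤n
  sum-map-mono (x ∷ xs) le = +-mono-≤ (le (here refl)) (sum-map-mono xs (le ∘ there))

  -- Termwise bounds whose totals meet leave no slack in any term. This turns each degree count
  -- below into information about single steps or vertices.
  sum-map-tight : {f g : A → ℕ} (xs : List A) → (∀ {x} → x ∈ xs → f x ≤ g x) →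
    sum (map g xs) ≤ sum (map f xs) → ∀ {x} → x ∈ xs → f x ≡ g x
  sum-map-tight {f} {g} (x ∷ xs) le ge (here refl) =
    ≤-antisym (le (here refl))
      (+-cancelʳ-≤ (sum (map g xs)) _ _
        (≤-trans ge (+-monoʳ-≤ (f x) (sum-map-mono xs (le ∘ there)))))
  sum-map-tight {f} {g} (x ∷ xs) le ge (there x∈) =
    sum-map-tight xs (le ∘ there)
      (+-cancelˡ-≤ (g x) _ _ (≤-trans ge (+-monoˡ-≤ _ (le (here refl))))) x∈

card-tabulate : ∀ {n} (f : Fin n → Bool) → ∣ tabulate f ∣ ≡ sum (List.tabulate (𝟙 ∘ f))
card-tabulate {zero}  f = refl
card-tabulate {suc n} f with f zero
... | true  = cong suc (card-tabulate (f ∘ suc))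
... | false = card-tabulate (f ∘ suc)

card-tabulate′ : ∀ {n} (f : Fin n → Bool) → ∣ tabulate f ∣ ≡ sum (map (𝟙 ∘ f) (allFin n))
card-tabulate′ f = trans (card-tabulate f) (cong sum (sym (map-tabulate id (𝟙 ∘ f))))

deg-sum : ∀ {n} (F : Graph n) x → deg F x ≡ sum (map (𝟙 ∘ adj F x) (allFin n))
deg-sum F x = card-tabulate′ (adj F x)

true≢false : ∀ {b} → b ≡ true → b ≡ false → ⊥
true≢false refl ()

∧-true : ∀ {a b} → a ∧ b ≡ true → a ≡ true × b ≡ true
∧-true {true} {true} _ = refl , refl

∧-intro : ∀ {a b} → a ≡ true → b ≡ true → a ∧ b ≡ true
∧-intro refl refl = refl

∨-true : ∀ {a b} → a ∨ b ≡ true → a ≡ true ⊎ b ≡ true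
∨-true {true}         _  = inj₁ refl
∨-true {false} {true} _  = inj₂ refl

⌊⌋-true : {A : Set} (d : Dec A) → ⌊ d ⌋ ≡ true → A
⌊⌋-true (yes a) _ = a

true-⌊⌋ : {A : Set} (d : Dec A) → A → ⌊ d ⌋ ≡ true
true-⌊⌋ (yes _) _ = refl
true-⌊⌋ (no ¬a) a = ⊥-elim (¬a a)

false-⌊⌋ : {A : Set} (d : Dec A) → ¬ A → ⌊ d ⌋ ≡ false
false-⌊⌋ (yes a) ¬a = ⊥-elim (¬a a)
false-⌊⌋ (no _)  _  = refl

sum-map-zero : {A : Set} {f : A → ℕ} (xs : List A) → (∀ {x} → x ∈ xs → f x ≡ 0) → sum (map f xs) ≡ 0
sum-map-zero []       eq = refl
sum-map-zero (x ∷ xs) eq = cong₂ _+_ (eq (here refl)) (sum-map-zero xs (eq ∘ there))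

sum-swap : {A B : Set} (f : A → B → ℕ) (xs : List A) (ys : List B) →
  sum (map (λ x → sum (map (f x) ys)) xs) ≡ sum (map (λ y → sum (map (λ x → f x y) xs)) ys)
sum-swap f []       ys = sym (sum-map-zero ys (λ _ → refl))
sum-swap f (x ∷ xs) ys = trans (cong (sum (map (f x) ys) +_) (sum-swap f xs ys))
  (sym (sum-map-+ (f x) (λ y → sum (map (λ x → f x y) xs)) ys))

≤-sum-map : {A : Set} {f : A → ℕ} {x : A} {xs : List A} → x ∈ xs → f x ≤ sum (map f xs)
≤-sum-map {f = f} {xs = x ∷ xs} (here refl) = m≤m+n (f x) _
≤-sum-map {f = f} {xs = x ∷ xs} (there x∈)  = ≤-trans (≤-sum-map x∈) (m≤n+m _ (f x))

sum-indicator : ∀ {n} (b : Bool) (j : Fin n) {xs : List (Fin n)} → Unique xs →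
  sum (map (λ i → 𝟙 (b ∧ ⌊ j Fin.≟ i ⌋)) xs) ≤ 𝟙 b
sum-indicator false j {xs} un = ≤-reflexive (sum-map-zero xs (λ _ → refl))
sum-indicator true  j []        = z≤n
sum-indicator true  j {x ∷ xs} (x∉ ∷ un) with j Fin.≟ x
... | no _     = sum-indicator true j un
... | yes refl = ≤-reflexive (cong suc (sum-map-zero xs
        (λ {i} i∈ → cong 𝟙 (false-⌊⌋ (j Fin.≟ i) (All.lookup x∉ i∈)))))

Unique-resp-↭ : {A : Set} {xs ys : List A} → xs ↭ ys → Unique xs → Unique ys
Unique-resp-↭ {A} p = PermSetoid.Unique-resp-↭ (setoid A) (Perm.↭⇒↭ₛ p)

module _ {A : Set} (_≟_ : DecidableEquality A) where

  open DecMembership _≟_ using (_∈?_)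

  -- States are described by permutations, and whether some state closes up has to be decided.
  permutation? : (xs ys : List A) → Dec (xs ↭ ys)
  permutation? []       []       = yes ↭-refl
  permutation? []       (y ∷ ys) = no λ p → PermP.¬x∷xs↭[] (↭-sym p)
  permutation? (x ∷ xs) ys with x ∈? ys
  ... | no x∉ = no λ p → x∉ (PermP.∈-resp-↭ p (here refl))
  ... | yes x∈ with ∈-∃++ x∈
  ...   | as , bs , refl = map′ (λ p → ↭-trans (prep x p) (↭-sym (PermP.shift x as bs)))
                             (PermP.drop-mid [] as) (permutation? xs (as ++ bs))

unique-++ʳ : {A : Set} (xs : List A) {x : A} {ys : List A} → Unique (xs ++ x ∷ ys) → x ∉ ys
unique-++ʳ []       un       = Unique[x∷xs]⇒x∉xs un
unique-++ʳ (_ ∷ xs) (_ ∷ un) = unique-++ʳ xs un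

unique-++-disjoint : {A : Set} {xs ys : List A} {w : A} → Unique (xs ++ ys) → w ∈ xs → w ∉ ys
unique-++-disjoint {xs = x ∷ xs} (x≢ ∷ un) (here refl) w∈ys = All.lookup x≢ (∈-++⁺ʳ xs w∈ys) refl
unique-++-disjoint {xs = x ∷ xs} (x≢ ∷ un) (there w∈)  w∈ys = unique-++-disjoint un w∈ w∈ys

unique-++⁻ˡ : {A : Set} (xs : List A) {ys : List A} → Unique (xs ++ ys) → Unique xs
unique-++⁻ˡ []       _        = []
unique-++⁻ˡ (x ∷ xs) (x≢ ∷ un) = All.tabulate (λ y∈ → All.lookup x≢ (∈-++⁺ˡ y∈)) ∷ unique-++⁻ˡ xs un

unique-++⁻ʳ : {A : Set} (xs : List A) {ys : List A} → Unique (xs ++ ys) → Unique ys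
unique-++⁻ʳ []       un       = un
unique-++⁻ʳ (_ ∷ xs) (_ ∷ un) = unique-++⁻ʳ xs un

concatMap-↭ : {A B : Set} (f : A → List B) {xs ys : List A} → xs ↭ ys → concatMap f xs ↭ concatMap f ys
concatMap-↭ f Perm.refl        = ↭-refl
concatMap-↭ f (Perm.prep x p)  = PermP.++⁺ˡ (f x) (concatMap-↭ f p)
concatMap-↭ f (Perm.swap x y p) =
  ↭-trans (PermP.++⁺ˡ (f x) (PermP.++⁺ˡ (f y) (concatMap-↭ f p))) (PermP.shifts (f x) (f y))
concatMap-↭ f (Perm.trans p q) = ↭-trans (concatMap-↭ f p) (concatMap-↭ f q)

pick : {A B : Set} (f : A → List B) {xs : List A} {w : B} → w ∈ concatMap f xs →
  ∃[ x ] ∃[ ys ] (xs ↭ x ∷ ys × w ∈ f x)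
pick f {x ∷ xs} w∈ with ∈-++⁻ (f x) w∈
... | inj₁ w∈x  = x , xs , ↭-refl , w∈x
... | inj₂ w∈xs with pick f w∈xs
...   | y , ys , p , w∈y = y , x ∷ ys , ↭-trans (prep x p) (Perm.swap x y ↭-refl) , w∈y

unique-count : {A : Set} (f : A → Bool) {xs ys : List A} → Unique xs → (∀ {x} → x ∈ xs → f x ≡ true) →
  (∀ {x} → x ∈ xs → x ∈ ys) → length xs ≤ sum (map (𝟙 ∘ f) ys)
unique-count f []        fx sub = z≤n
unique-count f {x ∷ xs} (x≢ ∷ un) fx sub with ∈-∃++ (sub (here refl))
... | as , bs , refl = begin
    suc (length xs)                        ≤⟨ s≤s (unique-count f un (fx ∘ there) sub′) ⟩
    suc (sum (map (𝟙 ∘ f) (as ++ bs)))      ≡⟨ cong (λ β → 𝟙 β + sum (map (𝟙 ∘ f) (as ++ bs))) (fx (here refl)) ⟨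
    sum (map (𝟙 ∘ f) (x ∷ as ++ bs))        ≡⟨ sum-↭ (PermP.map⁺ (𝟙 ∘ f) (PermP.shift x as bs)) ⟨
    sum (map (𝟙 ∘ f) (as ++ x ∷ bs))        ∎
  where
    open ≤-Reasoning
    sub′ : ∀ {y} → y ∈ xs → y ∈ as ++ bs
    sub′ y∈ with PermP.∈-resp-↭ (PermP.shift x as bs) (sub (there y∈))
    ... | here refl = ⊥-elim (All.lookup x≢ y∈ refl)
    ... | there y∈′ = y∈′

deg-count : ∀ {n} (F : Graph n) x {xs : List (Fin n)} → Unique xs → (∀ {y} → y ∈ xs → Adj F x y) → length xs ≤ deg F x
deg-count F x un ad = ≤-trans (unique-count (adj F x) un ad (λ {y} _ → ∈-allFin y)) (≤-reflexive (sym (deg-sum F x)))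

bipartition : {A : Set} (f : A → Bool) (xs : List A) → ∃[ ys ] ∃[ zs ]
  (xs ↭ ys ++ zs × (∀ {y} → y ∈ ys → f y ≡ true) × (∀ {z} → z ∈ zs → f z ≡ false))
bipartition f [] = [] , [] , ↭-refl , (λ ()) , λ ()
bipartition f (x ∷ xs) with bipartition f xs | f x in fx
... | ys , zs , p , ty , fz | true  = x ∷ ys , zs , prep x p , (λ { (here refl) → fx ; (there y∈) → ty y∈ }) , fz
... | ys , zs , p , ty , fz | false = ys , x ∷ zs , ↭-trans (prep x p) (↭-sym (PermP.shift x ys zs)) ,
        ty , (λ { (here refl) → fx ; (there z∈) → fz z∈ })

∈-tabulate⁺ : ∀ {n} {f : Fin n → Bool} {w} → f w ≡ true → w Sub.∈ tabulate f
∈-tabulate⁺ {f = f} {w} fw = lookup⇒[]= w (tabulate f) (trans (lookup∘tabulate f w) fw)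

∈-tabulate⁻ : ∀ {n} {f : Fin n → Bool} {w} → w Sub.∈ tabulate f → f w ≡ true
∈-tabulate⁻ {f = f} {w} w∈ = trans (sym (lookup∘tabulate f w)) ([]=⇒lookup w∈)

∉-tabulate⁻ : ∀ {n} {f : Fin n → Bool} {w} → w Sub.∉ tabulate f → f w ≡ false
∉-tabulate⁻ {f = f} {w} w∉ with f w in fw
... | false = refl
... | true  = ⊥-elim (w∉ (∈-tabulate⁺ {f = f} fw))

false-from : ∀ {b} → ¬ (b ≡ true) → b ≡ false
false-from {false} _ = refl
false-from {true}  h = ⊥-elim (h refl)

-- The unit saved is the missing loop at `w`; it enters the degree count behind (C2).
sum-others : ∀ {n} {w : Fin n} {xs : List (Fin n)} → w ∈ xs → suc (sum (map (λ r → 𝟙 (not ⌊ r Fin.≟ w ⌋)) xs)) ≤ length xs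
sum-others {w = w} {x ∷ xs} (here refl) rewrite true-⌊⌋ (x Fin.≟ x) refl = s≤s (begin
    sum (map (λ r → 𝟙 (not ⌊ r Fin.≟ w ⌋)) xs) ≤⟨ sum-map-mono xs (λ {r} _ → 𝟙≤1 (not ⌊ r Fin.≟ w ⌋)) ⟩
    sum (map (λ _ → 1) xs)                     ≡⟨ trans (sum-map-const 1 xs) (*-identityʳ _) ⟩
    length xs ∎)
  where open ≤-Reasoning
sum-others {w = w} {x ∷ xs} (there w∈) = ≤-trans
  (≤-reflexive (sym (+-suc (𝟙 (not ⌊ x Fin.≟ w ⌋)) _)))
  (+-mono-≤ (𝟙≤1 (not ⌊ x Fin.≟ w ⌋)) (sum-others w∈))

nth : {A : Set} → A → List A → ℕ → A
nth d []       _       = d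
nth d (x ∷ xs) zero    = x
nth d (x ∷ xs) (suc m) = nth d xs m

nth-∈ : {A : Set} (d : A) (xs : List A) {m : ℕ} → m < length xs → nth d xs m ∈ xs
nth-∈ d (x ∷ xs) {zero}  _         = here refl
nth-∈ d (x ∷ xs) {suc m} (s≤s m<)  = there (nth-∈ d xs m<)

nth-injective : {A : Set} (d : A) {xs : List A} → Unique xs → ∀ {m m′} → m < length xs → m′ < length xs →
  nth d xs m ≡ nth d xs m′ → m ≡ m′
nth-injective d un        {zero}  {zero}   _ _ _ = refl
nth-injective d {x ∷ xs} (x≢ ∷ un) {zero}  {suc m′} _ (s≤s m′<) eq = ⊥-elim (All.lookup x≢ (nth-∈ d xs m′<) eq)
nth-injective d {x ∷ xs} (x≢ ∷ un) {suc m} {zero}   (s≤s m<) _ eq = ⊥-elim (All.lookup x≢ (nth-∈ d xs m<) (sym eq))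
nth-injective d {x ∷ xs} (x≢ ∷ un) {suc m} {suc m′} (s≤s m<) (s≤s m′<) eq = cong suc (nth-injective d un m< m′< eq)

-- Labelled paths

module Paths {n : ℕ} {L : Set} (E : L → Graph n) where

  V : Set
  V = Fin n

  -- These are walks: repeated vertices and labels are allowed. In a state, the two permutation
  -- conditions exclude them.
  data Path : V → V → Set where
    []   : ∀ {x} → Path x x
    step : ∀ {x y z} (l : L) → Adj (E l) x y → Path y z → Path x z

  private variable
    x y a b c w v : V
    l m : L

  flipE : Adj (E l) a b → Adj (E l) b a
  flipE {l} {a} {b} e = trans (Graph.sym (E l) b a) e

  verts : Path x y → List V
  verts {x} []           = [ x ]
  verts {x} (step l e p) = x ∷ verts p

  steps : Path x y → List (V × L × V)
  steps []                       = []
  steps {x} (step {y = y} l e p) = (x , l , y) ∷ steps p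

  labelOf : V × L × V → L
  labelOf (_ , l , _) = l

  sourceOf targetOf : V × L × V → V
  sourceOf (a , _ , _) = a
  targetOf (_ , _ , b) = b

  labels : Path x y → List L
  labels p = map labelOf (steps p)

  start∈ : (p : Path x y) → x ∈ verts p
  start∈ []           = here refl
  start∈ (step l e p) = here refl

  end∈ : (p : Path x y) → y ∈ verts p
  end∈ []           = here refl
  end∈ (step l e p) = there (end∈ p)

  step-adj : (p : Path x y) → (a , l , b) ∈ steps p → Adj (E l) a b
  step-adj (step l e p) (here refl) = e
  step-adj (step l e p) (there st)  = step-adj p st

  source∈ : (p : Path x y) → (a , l , b) ∈ steps p → a ∈ verts p
  source∈ (step l e p) (here refl) = here refl
  source∈ (step l e p) (there st)  = there (source∈ p st)

  target∈ : (p : Path x y) → (a , l , b) ∈ steps p → b ∈ verts p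
  target∈ (step l e p) (here refl) = there (start∈ p)
  target∈ (step l e p) (there st)  = there (target∈ p st)

  join : Path x a → Adj (E l) a b → Path b y → Path x y
  join {l = l} []  e q = step l e q
  join (step m f p) e q = step m f (join p e q)

  verts-join : (p : Path x a) (e : Adj (E l) a b) (q : Path b y) →
    verts (join p e q) ≡ verts p ++ verts q
  verts-join []           e q = refl
  verts-join (step m f p) e q = cong (_ ∷_) (verts-join p e q)

  steps-join : (p : Path x a) (e : Adj (E l) a b) (q : Path b y) →
    steps (join p e q) ≡ steps p ++ (a , l , b) ∷ steps q
  steps-join []           e q = refl
  steps-join (step m f p) e q = cong (_ ∷_) (steps-join p e q)

  labels-join : (p : Path x a) (e : Adj (E l) a b) (q : Path b y) →
    labels (join p e q) ≡ labels p ++ l ∷ labels q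
  labels-join p e q = trans (cong (map labelOf) (steps-join p e q)) (map-++ labelOf (steps p) _)

  join-assoc : (p : Path x a) (e : Adj (E l) a b) (q : Path b c) {d : V} (f : Adj (E m) c d) (r : Path d y) →
    join (join p e q) f r ≡ join p e (join q f r)
  join-assoc []           e q f r = refl
  join-assoc (step m g p) e q f r = cong (step m g) (join-assoc p e q f r)

  module _ (p : Path x a) (e : Adj (E l) a b) (q : Path b y) where

    ∈-join⁺ˡ : w ∈ verts p → w ∈ verts (join p e q)
    ∈-join⁺ˡ w∈ = subst (_ ∈_) (sym (verts-join p e q)) (∈-++⁺ˡ w∈)

    ∈-join⁺ʳ : w ∈ verts q → w ∈ verts (join p e q)
    ∈-join⁺ʳ w∈ = subst (_ ∈_) (sym (verts-join p e q)) (∈-++⁺ʳ (verts p) w∈)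

    ∈-join⁻ : w ∈ verts (join p e q) → w ∈ verts p ⊎ w ∈ verts q
    ∈-join⁻ w∈ = ∈-++⁻ (verts p) (subst (_ ∈_) (verts-join p e q) w∈)

    step-join⁺ˡ : {t : V × L × V} → t ∈ steps p → t ∈ steps (join p e q)
    step-join⁺ˡ t∈ = subst (_ ∈_) (sym (steps-join p e q)) (∈-++⁺ˡ t∈)

    step-join⁺ᵐ : (a , l , b) ∈ steps (join p e q)
    step-join⁺ᵐ = subst (_ ∈_) (sym (steps-join p e q)) (∈-++⁺ʳ (steps p) (here refl))

    step-join⁺ʳ : {t : V × L × V} → t ∈ steps q → t ∈ steps (join p e q)
    step-join⁺ʳ t∈ = subst (_ ∈_) (sym (steps-join p e q)) (∈-++⁺ʳ (steps p) (there t∈))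

  rev : Path x y → Path y x
  rev []           = []
  rev (step l e p) = join (rev p) (flipE e) []

  verts-rev : (p : Path x y) → verts (rev p) ↭ verts p
  verts-rev []               = ↭-refl
  verts-rev {x} (step l e p) = ↭-trans (↭-reflexive (verts-join (rev p) (flipE e) []))
    (↭-trans (PermP.++-comm (verts (rev p)) [ x ]) (prep x (verts-rev p)))

  labels-rev : (p : Path x y) → labels (rev p) ↭ labels p
  labels-rev []           = ↭-refl
  labels-rev (step l e p) = ↭-trans (↭-reflexive (labels-join (rev p) (flipE e) []))
    (↭-trans (PermP.++-comm (labels (rev p)) [ l ]) (prep l (labels-rev p)))

  ∈-rev⁺ : (p : Path x y) → w ∈ verts p → w ∈ verts (rev p)
  ∈-rev⁺ p w∈ = PermP.∈-resp-↭ (↭-sym (verts-rev p)) w∈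

  ∈-rev⁻ : (p : Path x y) → w ∈ verts (rev p) → w ∈ verts p
  ∈-rev⁻ p w∈ = PermP.∈-resp-↭ (verts-rev p) w∈

  step-rev⁺ : (p : Path x y) → (a , l , b) ∈ steps p → (b , l , a) ∈ steps (rev p)
  step-rev⁺ (step l e p) (here refl) = step-join⁺ᵐ (rev p) (flipE e) []
  step-rev⁺ (step l e p) (there st)  = step-join⁺ˡ (rev p) (flipE e) [] (step-rev⁺ p st)

  rev-join : (p : Path x a) (e : Adj (E l) a b) (q : Path b y) →
    rev (join p e q) ≡ join (rev q) (flipE e) (rev p)
  rev-join []           e q = refl
  rev-join (step m f p) e q =
    trans (cong (λ r → join r (flipE f) []) (rev-join p e q)) (join-assoc (rev q) (flipE e) (rev p) (flipE f) [])

  step-join⁻ : (p : Path x a) (e : Adj (E l) a b) (q : Path b y) {t : V × L × V} → t ∈ steps (join p e q) →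
    t ∈ steps p ⊎ t ≡ (a , l , b) ⊎ t ∈ steps q
  step-join⁻ p e q t∈ with ∈-++⁻ (steps p) (subst (_ ∈_) (steps-join p e q) t∈)
  ... | inj₁ t∈p         = inj₁ t∈p
  ... | inj₂ (here eq)   = inj₂ (inj₁ eq)
  ... | inj₂ (there t∈q) = inj₂ (inj₂ t∈q)

  step-rev⁻ : (P : Path x y) → (a , l , b) ∈ steps (rev P) → (b , l , a) ∈ steps P
  step-rev⁻ (step l e P) t∈ with step-join⁻ (rev P) (flipE e) [] t∈
  ... | inj₁ t∈P         = there (step-rev⁻ P t∈P)
  ... | inj₂ (inj₁ refl) = here refl

  verts≡start∷targets : (p : Path x y) → verts p ≡ x ∷ map targetOf (steps p)
  verts≡start∷targets []           = refl
  verts≡start∷targets (step l e p) = cong (_ ∷_) (verts≡start∷targets p)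

  verts≡sources∷ʳend : (p : Path x y) → verts p ≡ map sourceOf (steps p) ++ [ y ]
  verts≡sources∷ʳend []           = refl
  verts≡sources∷ʳend (step l e p) = cong (_ ∷_) (verts≡sources∷ʳend p)

  length-verts : (p : Path x y) → length (verts p) ≡ suc (length (steps p))
  length-verts p = trans (cong length (verts≡start∷targets p)) (cong suc (length-map targetOf (steps p)))

  data SplitAt {x y : V} (P : Path x y) (a : V) (l : L) (b : V) : Set where
    splitAt : (p : Path x a) (e : Adj (E l) a b) (q : Path b y) → P ≡ join p e q → SplitAt P a l b

  split : (P : Path x y) → (a , l , b) ∈ steps P → SplitAt P a l b
  split (step l e q) (here refl) = splitAt [] e q refl
  split (step l e q) (there st) with split q st
  ... | splitAt p f r refl = splitAt (step l e p) f r refl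

  labelled-step : (P : Path x y) → l ∈ labels P → ∃[ a ] ∃[ b ] ((a , l , b) ∈ steps P)
  labelled-step P l∈ with ∈-map⁻ labelOf l∈
  ... | (a , l , b) , st , refl = a , b , st

  target-or-start : (P : Path x y) → w ∈ verts P → w ≡ x ⊎ ∃[ a ] ∃[ l ] ((a , l , w) ∈ steps P)
  target-or-start P w∈ with subst (_ ∈_) (verts≡start∷targets P) w∈
  ... | here refl = inj₁ refl
  ... | there w∈′ with ∈-map⁻ targetOf w∈′
  ...   | (a , l , _) , st , refl = inj₂ (a , l , st)

  source-or-end : (P : Path x y) → w ∈ verts P → (∃[ l ] ∃[ b ] ((w , l , b) ∈ steps P)) ⊎ w ≡ y
  source-or-end P w∈ with ∈-++⁻ (map sourceOf (steps P)) (subst (_ ∈_) (verts≡sources∷ʳend P) w∈)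
  ... | inj₂ (here refl) = inj₂ refl
  ... | inj₁ w∈′ with ∈-map⁻ sourceOf w∈′
  ...   | (_ , l , b) , st , refl = inj₁ (l , b , st)

  -- The decomposition is stored because it is the one at which the path gets rotated to make `w`
  -- its start.
  data Before {x y : V} (P : Path x y) (w v : V) : Set where
    before : ∀ {l b} (p : Path x w) (e : Adj (E l) w b) (q : Path b y) → P ≡ join p e q → v ∈ verts q → Before P w v

  Before-step : {e : Adj (E l) x a} {p : Path a y} → Before p w v → Before (step l e p) w v
  Before-step {l = l} {e = e} (before p f q refl v∈) = before (step l e p) f q refl v∈

  Before-join : (p : Path x a) (e : Adj (E l) a b) (q : Path b y) → w ∈ verts p → v ∈ verts q →
    Before (join p e q) w v
  Before-join []           e q (here refl) v∈ = before [] e q refl v∈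
  Before-join (step m f p) e q (here refl) v∈ = before [] f (join p e q) refl (∈-join⁺ʳ p e q v∈)
  Before-join (step m f p) e q (there w∈)  v∈ = Before-step (Before-join p e q w∈ v∈)

  Before-joinʳ : (p : Path x a) (e : Adj (E l) a b) {q : Path b y} → Before q w v → Before (join p e q) w v
  Before-joinʳ []           e bf = Before-step bf
  Before-joinʳ (step m f p) e bf = Before-step (Before-joinʳ p e bf)

  Before-total : (P : Path x y) → w ∈ verts P → v ∈ verts P → w ≢ v → Before P w v ⊎ Before P v w
  Before-total []           (here refl) (here refl) w≢v = ⊥-elim (w≢v refl)
  Before-total (step l e p) (here refl) (here refl) w≢v = ⊥-elim (w≢v refl)
  Before-total (step l e p) (here refl) (there v∈)  w≢v = inj₁ (before [] e p refl v∈)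
  Before-total (step l e p) (there w∈)  (here refl) w≢v = inj₂ (before [] e p refl w∈)
  Before-total (step l e p) (there w∈)  (there v∈)  w≢v with Before-total p w∈ v∈ w≢v
  ... | inj₁ bf = inj₁ (Before-step bf)
  ... | inj₂ bf = inj₂ (Before-step bf)

  nth-start : ∀ {x y} d (P : Path x y) → nth d (verts P) 0 ≡ x
  nth-start d []           = refl
  nth-start d (step l e P) = refl

  nth-end : ∀ {x y} d (P : Path x y) → nth d (verts P) (length (steps P)) ≡ y
  nth-end d []           = refl
  nth-end d (step l e P) = nth-end d P

  nth-step : ∀ {x y} d d′ (P : Path x y) {m} → m < length (steps P) →
    (nth d (verts P) m , nth d′ (labels P) m , nth d (verts P) (suc m)) ∈ steps P
  nth-step d d′ (step l e P) {zero}  _        = here (cong (λ z → _ , l , z) (nth-start d P))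
  nth-step d d′ (step l e P) {suc m} (s≤s m<) = there (nth-step d d′ P m<)

  step-nth : ∀ {x y} d d′ (P : Path x y) {a l b} → (a , l , b) ∈ steps P →
    ∃[ m ] (m < length (steps P) × nth d (verts P) m ≡ a × nth d′ (labels P) m ≡ l × nth d (verts P) (suc m) ≡ b)
  step-nth d d′ (step l e P) (here refl) = 0 , s≤s z≤n , refl , refl , nth-start d P
  step-nth d d′ (step l e P) (there st) with step-nth d d′ P st
  ... | m , m< , p , q , r = suc m , s≤s m< , p , q , r

module _ {n : ℕ} {L : Set} {E E′ : L → Graph n} where

  private
    module E = Paths E
    module E′ = Paths E′

  -- Only the labels that occur must keep their graph, so the graph of an absent label can be
  -- exchanged freely.
  transport-path : ∀ {x y} (P : E.Path x y) → (∀ {l} → l ∈ E.labels P → E l ≡ E′ l) →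
    Σ (E′.Path x y) λ P′ → E′.verts P′ ≡ E.verts P × E′.labels P′ ≡ E.labels P
  transport-path E.[] eq = E′.[] , refl , refl
  transport-path (E.step {x} {y} l e P) eq with transport-path P (eq ∘ there)
  ... | P′ , vs , ls = E′.step l (subst (λ F → Adj F x y) (eq (here refl)) e) P′ , cong (x ∷_) vs , cong (l ∷_) ls

-- Spanning paths with two spare labels

-- For a step whose label is fixed or free according to `f`: exactly one of the two crossing
-- adjacencies holds at a free step, and both hold at a fixed one.
Balanced : Bool → Bool → Bool → Set
Balanced f p q = 𝟙 p + 𝟙 q ≡ suc (𝟙 f)

balanced-fixed : ∀ {f p q} → Balanced f p q → f ≡ true → p ≡ true × q ≡ true
balanced-fixed {true} {true} {true} _ _ = refl , refl
balanced-fixed {true} {true} {false} () _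
balanced-fixed {true} {false} {true} () _
balanced-fixed {true} {false} {false} () _

balanced-free : ∀ {f p q} → Balanced f p q → f ≡ false → p ≡ not q
balanced-free {false} {true} {false} _ _ = refl
balanced-free {false} {false} {true} _ _ = refl
balanced-free {false} {true} {true} () _
balanced-free {false} {false} {false} () _

balanced-falseʳ : ∀ {f p q} → Balanced f p q → q ≡ false → f ≡ false × p ≡ true
balanced-falseʳ {false} {true} {false} _ _ = refl , refl
balanced-falseʳ {true}  {true} {false} () _
balanced-falseʳ {_}     {false} {false} () _

balanced-falseˡ : ∀ {f p q} → Balanced f p q → p ≡ false → f ≡ false × q ≡ true
balanced-falseˡ {false} {false} {true} _ _ = refl , refl
balanced-falseˡ {true}  {false} {true} () _
balanced-falseˡ {_}     {false} {false} () _

𝟙-injective : ∀ {p q} → 𝟙 p ≡ 𝟙 q → p ≡ q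
𝟙-injective {true}  {true}  _ = refl
𝟙-injective {false} {false} _ = refl
𝟙-injective {true}  {false} ()
𝟙-injective {false} {true}  ()

balanced-uniqueˡ : ∀ {f p p′ q} → Balanced f p q → Balanced f p′ q → p ≡ p′
balanced-uniqueˡ {q = q} B B′ = 𝟙-injective (+-cancelʳ-≡ (𝟙 q) _ _ (trans B (sym B′)))

balanced-uniqueʳ : ∀ {f p q q′} → Balanced f p q → Balanced f p q′ → q ≡ q′
balanced-uniqueʳ {p = p} B B′ = 𝟙-injective (+-cancelˡ-≡ (𝟙 p) _ _ (trans B (sym B′)))

+-tight : ∀ {a b c} → a ≤ c → b ≤ c → a + b ≡ c + c → a ≡ c
+-tight {a} {b} {c} a≤c b≤c eq =
  ≤-antisym a≤c (+-cancelʳ-≤ c c a (≤-trans (≤-reflexive (sym eq)) (+-monoʳ-≤ a b≤c)))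

-- A state is a spanning path using every label but the two spare ones i and s;
-- an edge of E i or E s between its ends would close it to a spanning rainbow cycle.
module States {n : ℕ} (E : Fin (suc n) → Graph n) (fixed : Fin (suc n) → Bool) where

  open Paths E public

  private variable
    x y a b w v : V
    i s l m : Fin (suc n)

  record State {x y : V} (P : Path x y) (i s : Fin (suc n)) : Set where
    constructor state
    field
      span   : verts P ↭ allFin n
      spare  : i ∷ s ∷ labels P ↭ allFin (suc n)
      free-i : fixed i ≡ false
      free-s : fixed s ≡ false
  open State public

  swap : {P : Path x y} → State P i s → State P s i
  swap St = state (St .span) (↭-trans (Perm.swap _ _ ↭-refl) (St .spare)) (St .free-s) (St .free-i)

  reverseState : {P : Path x y} → State P i s → State (rev P) i s
  reverseState {P = P} St = state (↭-trans (verts-rev P) (St .span))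
    (↭-trans (prep _ (prep _ (labels-rev P))) (St .spare)) (St .free-i) (St .free-s)

  -- Pósa rotation: the chord from `x` to `b` in the spare label `i` replaces the step from `a` to
  -- `b`, whose label becomes spare instead. That label must be free, since spare labels are.
  rotate : (p : Path x a) (e : Adj (E l) a b) (q : Path b y) → State (join p e q) i s →
    fixed l ≡ false → (f : Adj (E i) x b) → State (join (rev p) f q) l s
  rotate {l = l} {i = i} {s = s} p e q St fr f = state
    (↭-trans (↭-reflexive (verts-join (rev p) f q))
      (↭-trans (PermP.++⁺ʳ (verts q) (verts-rev p))
        (↭-trans (↭-reflexive (sym (verts-join p e q))) (St .span))))
    (begin
      l ∷ s ∷ labels (join (rev p) f q)          ≡⟨ cong (λ z → l ∷ s ∷ z) (labels-join (rev p) f q) ⟩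
      l ∷ s ∷ (labels (rev p) ++ i ∷ labels q)   ↭⟨ prep l (prep s (PermP.++⁺ʳ _ (labels-rev p))) ⟩
      l ∷ s ∷ (labels p ++ i ∷ labels q)         ↭⟨ prep l (prep s (PermP.shift i (labels p) (labels q))) ⟩
      l ∷ s ∷ i ∷ (labels p ++ labels q)         ↭⟨ prep l (Perm.swap s i ↭-refl) ⟩
      l ∷ i ∷ s ∷ (labels p ++ labels q)         ↭⟨ Perm.swap l i ↭-refl ⟩
      i ∷ l ∷ s ∷ (labels p ++ labels q)         ↭⟨ prep i (Perm.swap l s ↭-refl) ⟩
      i ∷ s ∷ l ∷ (labels p ++ labels q)         ↭⟨ prep i (prep s (↭-sym (PermP.shift l (labels p) (labels q)))) ⟩
      i ∷ s ∷ (labels p ++ l ∷ labels q)         ≡⟨ cong (λ z → i ∷ s ∷ z) (sym (labels-join p e q)) ⟩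
      i ∷ s ∷ labels (join p e q)                ↭⟨ St .spare ⟩
      allFin (suc n)                             ∎)
    fr (St .free-s)
    where open PermutationReasoning

  all-verts : {P : Path x y} → State P i s → ∀ w → w ∈ verts P
  all-verts St w = PermP.∈-resp-↭ (↭-sym (St .span)) (∈-allFin w)

  label-cases : {P : Path x y} → State P i s → ∀ l → l ≡ i ⊎ l ≡ s ⊎ l ∈ labels P
  label-cases St l with PermP.∈-resp-↭ (↭-sym (St .spare)) (∈-allFin l)
  ... | here eq           = inj₁ eq
  ... | there (here eq)   = inj₂ (inj₁ eq)
  ... | there (there l∈)  = inj₂ (inj₂ l∈)

  fixed-used : {P : Path x y} → State P i s → ∀ l → fixed l ≡ true → l ∈ labels P
  fixed-used St l fx with label-cases St l
  ... | inj₁ refl        = ⊥-elim (true≢false fx (St .free-i))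
  ... | inj₂ (inj₁ refl) = ⊥-elim (true≢false fx (St .free-s))
  ... | inj₂ (inj₂ l∈)   = l∈

  suc-length-steps : {P : Path x y} → State P i s → suc (length (steps P)) ≡ n
  suc-length-steps {P = P} St = trans (sym (length-verts P))
    (trans (PermP.↭-length (St .span)) (length-tabulate id))

  unique-verts : {P : Path x y} → State P i s → Unique (verts P)
  unique-verts St = Unique-resp-↭ (↭-sym (St .span)) (allFin⁺ n)

  ends-distinct : 2 ≤ n → {P : Path x y} → State P i s → x ≢ y
  ends-distinct 2≤n {[]}         St refl = 1+n≰n (≤-trans 2≤n (≤-reflexive (sym (suc-length-steps St))))
  ends-distinct 2≤n {step l e p} St refl = Unique[x∷xs]⇒x∉xs (unique-verts St) (end∈ p)

  -- Naming one spare label is enough, as `swap` exchanges the two.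
  NoClosure : Set
  NoClosure = ∀ {x y i s} {P : Path x y} → State P i s → adj (E i) x y ≡ false

-- Equality at every step, and what rotations make of it

module Core {n k : ℕ} (2≤n : 2 ≤ n) (E : Fin (suc n) → Graph n) (fixed : Fin (suc n) → Bool)
  (few-fixed : sum (map (𝟙 ∘ fixed) (allFin (suc n))) ≤ suc k)
  (ore : ∀ l → fixed l ≡ false → σ₂≥ (E l) (n + k))
  (noClosure : States.NoClosure E fixed) where

  open States E fixed

  private variable
    x y a b c d w v z : V
    i s l m t : Fin (suc n)
    P : Path x y

  ends-nonadjacent : {P : Path x y} → State P i s → adj (E i) y x ≡ false
  ends-nonadjacent {x} {y} {i} St = trans (Graph.sym (E i) y x) (noClosure St)

  module _ {x y : V} {i s : Fin (suc n)} {P : Path x y} (St : State P i s) where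

    -- Each vertex other than `x` is the target of one step. Counting the neighbours of `x` at
    -- targets and those of `y` at sources places both degrees on the steps, where a pair of
    -- adjacencies is a possible way to close up.
    deg-targets : ∀ l → deg (E l) x ≡ sum (map (𝟙 ∘ adj (E l) x ∘ targetOf) (steps P))
    deg-targets l = begin
      deg (E l) x                                            ≡⟨ deg-sum (E l) x ⟩
      sum (map f (allFin n))                                 ≡⟨ sum-↭ (PermP.map⁺ f (St .span)) ⟨
      sum (map f (verts P))                                  ≡⟨ cong (sum ∘ map f) (verts≡start∷targets P) ⟩
      f x + sum (map f (map targetOf (steps P)))             ≡⟨ cong (λ z → 𝟙 z + sum (map f (map targetOf (steps P)))) (irrefl (E l) x) ⟩
      sum (map f (map targetOf (steps P)))                   ≡⟨ cong sum (map-∘ (steps P)) ⟨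
      sum (map (f ∘ targetOf) (steps P))                     ∎
      where open ≡-Reasoning
            f = 𝟙 ∘ adj (E l) x

    deg-sources : ∀ l → deg (E l) y ≡ sum (map (𝟙 ∘ adj (E l) y ∘ sourceOf) (steps P))
    deg-sources l = begin
      deg (E l) y                                            ≡⟨ deg-sum (E l) y ⟩
      sum (map f (allFin n))                                 ≡⟨ sum-↭ (PermP.map⁺ f (St .span)) ⟨
      sum (map f (verts P))                                  ≡⟨ cong (sum ∘ map f) (verts≡sources∷ʳend P) ⟩
      sum (map f (map sourceOf (steps P) ++ y ∷ []))         ≡⟨ cong sum (map-++ f (map sourceOf (steps P)) _) ⟩
      sum (map f (map sourceOf (steps P)) ++ f y ∷ [])       ≡⟨ sum-++ (map f (map sourceOf (steps P))) _ ⟩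
      sum (map f (map sourceOf (steps P))) + (f y + 0)       ≡⟨ cong (λ z → sum (map f (map sourceOf (steps P))) + (z + 0)) (cong 𝟙 (irrefl (E l) y)) ⟩
      sum (map f (map sourceOf (steps P))) + 0               ≡⟨ +-identityʳ _ ⟩
      sum (map f (map sourceOf (steps P)))                   ≡⟨ cong sum (map-∘ (steps P)) ⟨
      sum (map (f ∘ sourceOf) (steps P))                     ∎
      where open ≡-Reasoning
            f = 𝟙 ∘ adj (E l) y

    capacity : V × Fin (suc n) × V → ℕ
    capacity t = suc (𝟙 (fixed (labelOf t)))

    few-fixed-steps : sum (map (𝟙 ∘ fixed) (labels P)) ≤ suc k
    few-fixed-steps = begin
      sum (map (𝟙 ∘ fixed) (labels P))                              ≤⟨ m≤n+m _ (𝟙 (fixed s)) ⟩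
      𝟙 (fixed s) + sum (map (𝟙 ∘ fixed) (labels P))                ≤⟨ m≤n+m _ (𝟙 (fixed i)) ⟩
      sum (map (𝟙 ∘ fixed) (i ∷ s ∷ labels P))                      ≡⟨ sum-↭ (PermP.map⁺ (𝟙 ∘ fixed) (St .spare)) ⟩
      sum (map (𝟙 ∘ fixed) (allFin (suc n)))                        ≤⟨ few-fixed ⟩
      suc k                                                         ∎
      where open ≤-Reasoning

    -- One unit for each of the n - 1 steps and a second one for each of at most k + 1 fixed labels.
    total-capacity : sum (map capacity (steps P)) ≤ n + k
    total-capacity = begin
      sum (map capacity (steps P))                                ≡⟨ sum-map-+ (λ _ → 1) (𝟙 ∘ fixed ∘ labelOf) (steps P) ⟩
      sum (map (λ _ → 1) (steps P)) + sum (map (𝟙 ∘ fixed ∘ labelOf) (steps P))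
                                                                  ≡⟨ cong₂ _+_ (trans (sum-map-const 1 (steps P)) (*-identityʳ _)) (cong sum (map-∘ (steps P))) ⟩
      length (steps P) + sum (map (𝟙 ∘ fixed) (labels P))         ≤⟨ +-monoʳ-≤ (length (steps P)) few-fixed-steps ⟩
      length (steps P) + suc k                                    ≡⟨ +-suc _ k ⟩
      suc (length (steps P)) + k                                  ≡⟨ cong (_+ k) (suc-length-steps St) ⟩
      n + k                                                       ∎
      where open ≤-Reasoning

    ore-ends : n + k ≤ deg (E i) x + deg (E i) y
    ore-ends = ore i (St .free-i) x y (ends-distinct 2≤n St) (true≢false′ (noClosure St))
      where true≢false′ : ∀ {b} → b ≡ false → b ≢ true
            true≢false′ refl ()

  crossing : Fin (suc n) → Fin (suc n) → V → V → V × Fin (suc n) × V → ℕ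
  crossing i s x y (a , _ , b) = 𝟙 (adj (E i) x b) + 𝟙 (adj (E s) y a)

  -- If both adjacencies held at a free step, the chord in `i` would rotate the path to one from `a`
  -- to `y` that still has `s` spare, and the edge between `y` and `a` in `s` would close it.
  crossing≤capacity : {P : Path x y} (St : State P i s) → ∀ {t} → t ∈ steps P → crossing i s x y t ≤ capacity St t
  crossing≤capacity {x} {y} {i} {s} {P} St {a , l , b} t∈ with fixed l in fl
  ... | true = +-mono-≤ (𝟙≤1 (adj (E i) x b)) (𝟙≤1 (adj (E s) y a))
  ... | false with adj (E i) x b in xb | adj (E s) y a in ya
  ...   | false | q     = 𝟙≤1 q
  ...   | true  | false = ≤-refl
  ...   | true  | true with split P t∈
  ...     | splitAt p e q refl =
              ⊥-elim (true≢false ya (ends-nonadjacent (swap (rotate p e q St fl xb))))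

  crossing-sum : {P : Path x y} (St : State P i s) → sum (map (crossing i s x y) (steps P)) ≡ deg (E i) x + deg (E s) y
  crossing-sum {x} {y} {i} {s} {P} St =
    trans (sum-map-+ (𝟙 ∘ adj (E i) x ∘ targetOf) (𝟙 ∘ adj (E s) y ∘ sourceOf) (steps P))
      (sym (cong₂ _+_ (deg-targets St i) (deg-sources St s)))

  deg-bound : {P : Path x y} → State P i s → deg (E i) x + deg (E s) y ≤ n + k
  deg-bound St = ≤-trans (≤-reflexive (sym (crossing-sum St)))
    (≤-trans (sum-map-mono _ (crossing≤capacity St)) (total-capacity St))

  tight : {P : Path x y} → State P i s → (a , l , b) ∈ steps P →
    Balanced (fixed l) (adj (E i) x b) (adj (E s) y a)
  tight {x} {y} {i} {s} {P = P} St st∈ =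
    -- The counts for (i, s) and (s, i) are each bounded by the capacity and together fill it twice,
    -- so each fills it alone.
    +-tight (crossing≤capacity St st∈) (crossing≤capacity (swap St) st∈)
      (sum-map-tight (steps P)
        (λ t∈ → +-mono-≤ (crossing≤capacity St t∈) (crossing≤capacity (swap St) t∈)) enough st∈)
    where
      open ≤-Reasoning
      dix = deg (E i) x
      diy = deg (E i) y
      dsx = deg (E s) x
      dsy = deg (E s) y
      rearrange : (dix + diy) + (dsx + dsy) ≡ (dix + dsy) + (dsx + diy)
      rearrange = solve 4 (λ p q r t → (p :+ q) :+ (r :+ t) := (p :+ t) :+ (r :+ q)) refl dix diy dsx dsy
        where open +-*-Solver
      enough : sum (map (λ t → capacity St t + capacity St t) (steps P)) ≤
               sum (map (λ t → crossing i s x y t + crossing s i x y t) (steps P))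
      enough = begin
        sum (map (λ t → capacity St t + capacity St t) (steps P)) ≡⟨ sum-map-+ (capacity St) (capacity St) (steps P) ⟩
        sum (map (capacity St) (steps P)) + sum (map (capacity St) (steps P))
                                                             ≤⟨ +-mono-≤ (total-capacity St) (total-capacity St) ⟩
        (n + k) + (n + k)                                    ≤⟨ +-mono-≤ (ore-ends St) (ore-ends (swap St)) ⟩
        (dix + diy) + (dsx + dsy)                            ≡⟨ rearrange ⟩
        (dix + dsy) + (dsx + diy)                            ≡⟨ cong₂ _+_ (crossing-sum St) (crossing-sum (swap St)) ⟨
        sum (map (crossing i s x y) (steps P)) + sum (map (crossing s i x y) (steps P))
                                                             ≡⟨ sum-map-+ (crossing i s x y) (crossing s i x y) (steps P) ⟨
        sum (map (λ t → crossing i s x y t + crossing s i x y t) (steps P)) ∎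

  -- Recolouring the first step with i or s makes all of i, s and its label t spare in turn.
  start-agree : {P : Path x y} → State P i s → ∀ w → adj (E i) x w ≡ adj (E s) x w
  start-agree {x} {y} {i} {s} {P = []} St w = ⊥-elim (ends-distinct 2≤n St refl)
  start-agree {x} {y} {i} {s} {P = step t e q} St w with target-or-start (step t e q) (all-verts St w)
  ... | inj₁ refl = trans (irrefl (E i) x) (sym (irrefl (E s) x))
  ... | inj₂ (a , l , here refl) =
          trans (proj₂ (balanced-falseʳ (tight St (here refl)) (ends-nonadjacent (swap St))))
            (sym (proj₂ (balanced-falseʳ (tight (swap St) (here refl)) (ends-nonadjacent St))))
  ... | inj₂ (a , l , there st) =
          balanced-uniqueˡ (tight St (there st))
            (subst (Balanced (fixed l) _) y-agree (tight (swap St) (there st)))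
    where
      fi = balanced-falseʳ (tight St (here refl)) (ends-nonadjacent (swap St))
      fs = balanced-falseʳ (tight (swap St) (here refl)) (ends-nonadjacent St)
      y-agree : adj (E i) y a ≡ adj (E s) y a
      y-agree = balanced-uniqueʳ
        (tight (rotate [] e q (swap St) (proj₁ fs) (proj₂ fs)) (there st))
        (tight (rotate [] e q St (proj₁ fi) (proj₂ fi)) (there st))

  end-agree : {P : Path x y} → State P i s → ∀ w → adj (E i) y w ≡ adj (E s) y w
  end-agree St = start-agree (reverseState St)

  module _ {x a b y : V} {l : Fin (suc n)} (p : Path x a) (e : Adj (E l) a b) (q : Path b y) where

    -- The steps leaving a non-neighbour of `y` are those at which one can rotate: tightness makes
    -- the label free and supplies the chord.
    pivot : State (join p e q) i s → adj (E i) y a ≡ false → fixed l ≡ false × Adj (E i) x b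
    pivot St ya = balanced-falseʳ (tight St (step-join⁺ᵐ p e q)) (trans (sym (end-agree St a)) ya)

    turn : (St : State (join p e q) i s) (ya : adj (E i) y a ≡ false) →
      State (join (rev p) (proj₂ (pivot St ya)) q) l s
    turn St ya = rotate p e q St (proj₁ (pivot St ya)) (proj₂ (pivot St ya))

    module _ (St : State (join p e q) i s) (ya : adj (E i) y a ≡ false) where

      private
        f = proj₂ (pivot St ya)
        R = turn St ya

      -- The rotated path runs through the prefix backwards, so its tightness pairs the new start
      -- with `c` and the end `y` with `d`. The freed label is traded for `s` by `end-agree`.
      turn-prefix : (c , m , d) ∈ steps p → Balanced (fixed m) (adj (E s) a c) (adj (E s) y d)
      turn-prefix st = subst (Balanced _ _) (end-agree R _)
        (tight (swap R) (step-join⁺ˡ (rev p) f q (step-rev⁺ p st)))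

      -- Both paths share the steps of the suffix and the end `y`. By tightness the adjacencies of
      -- `y` determine those of the start, so the old start and the new one have the same neighbours
      -- there.
      turn-suffix : w ∈ verts q → adj (E s) a w ≡ adj (E s) x w
      turn-suffix {w} w∈ with target-or-start q w∈
      ... | inj₁ refl = trans
              (proj₂ (balanced-falseʳ (tight (swap R) (step-join⁺ᵐ (rev p) f q))
                       (trans (end-agree R x) (ends-nonadjacent (swap St)))))
              (trans (sym f) (start-agree St b))
      ... | inj₂ (c , m , st) = balanced-uniqueˡ
              (subst (Balanced _ _) (trans (end-agree R c) (sym (end-agree St c)))
                (tight (swap R) (step-join⁺ʳ (rev p) f q st)))
              (tight (swap St) (step-join⁺ʳ p e q st))

  -- Rotation makes `w` the start and leaves everything after `w` in place. This is how the count at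
  -- the ends says something about pairs of inner vertices.
  earlier-nonneighbour : {P : Path x y} → State P i s → Before P w v → adj (E i) y w ≡ false →
    adj (E i) w v ≡ adj (E i) x v
  earlier-nonneighbour St (before p e q refl v∈) yw =
    turn-suffix p e q (swap St) (trans (sym (end-agree St _)) yw) v∈

  nonneighbour-prefix : (p : Path x a) (e : Adj (E l) a b) (q : Path b y) → State (join p e q) i s →
    adj (E i) y a ≡ false → (c , m , d) ∈ steps p → Balanced (fixed m) (adj (E i) a c) (adj (E i) y d)
  nonneighbour-prefix p e q St ya st =
    turn-prefix p e q (swap St) (trans (sym (end-agree St _)) ya) st

  adj-sym : ∀ l a b → adj (E l) a b ≡ adj (E l) b a
  adj-sym l = Graph.sym (E l)

  -- Rotating at a non-neighbour w of y reverses the first step, so its tightness now concerns w and x.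
  first-step-nested : {e : Adj (E t) x b} (q : Path b y) → State (step t e q) i s → adj (E i) y b ≡ true →
    ∀ w → adj (E i) y w ≡ false → adj (E i) x w ≡ false
  first-step-nested {t} {x} {b} {y} {i} {s} {e} q St yb w yw with source-or-end (step t e q) (all-verts St w)
  ... | inj₂ refl = noClosure St
  ... | inj₁ (_ , _ , here refl) = irrefl (E i) x
  ... | inj₁ (_ , _ , there st) with split q st
  ...   | splitAt p f r refl = trans (adj-sym i x w) (trans (balanced-free
            (nonneighbour-prefix (step t e p) f r St yw (here refl))
            (proj₁ (pivot [] e (join p f r) St (ends-nonadjacent St)))) (cong not yb))

  -- The non-neighbours of y do not form an initial segment: rotating at z shows that z is not
  -- adjacent to x, which forces the second vertex of the path to be a neighbour of y.
  returning-nested : {P : Path x y} (p : Path x a) (e : Adj (E l) a b) (q : Path b y) → P ≡ join p e q →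
    State P i s → adj (E i) y a ≡ false → adj (E i) y b ≡ true →
    (z , m , d) ∈ steps q → adj (E i) y z ≡ false →
    ∀ w → adj (E i) y w ≡ false → adj (E i) x w ≡ false
  returning-nested {i = i} {z = z} p e q eq St ya yb z∈ yz with split q z∈
  returning-nested {x} {y} {a} {l} {b} {i} {s} {z = z} p e _ refl St ya yb z∈ yz | splitAt q₁ e₁ q₂ refl = go p refl
    where
      prefix : ∀ {c m d} → (c , m , d) ∈ steps (join p e q₁) → Balanced (fixed m) (adj (E i) z c) (adj (E i) y d)
      prefix = nonneighbour-prefix (join p e q₁) e₁ q₂
        (subst (λ r → State r i s) (sym (join-assoc p e q₁ e₁ q₂)) St) yz
      za : adj (E i) z a ≡ false
      za = trans (balanced-free (prefix (step-join⁺ᵐ p e q₁)) (proj₁ (pivot p e _ St ya))) (cong not yb)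
      zx : adj (E i) z x ≡ false
      zx = trans (adj-sym i z x) (trans
        (sym (earlier-nonneighbour St (before p e _ refl (∈-join⁺ˡ q₁ e₁ q₂ (end∈ q₁))) ya))
        (trans (adj-sym i a z) za))
      go : (p′ : Path x a) → p ≡ p′ → ∀ w → adj (E i) y w ≡ false → adj (E i) x w ≡ false
      go [] refl = first-step-nested _ St yb
      go (step t f p′) refl = first-step-nested _ St
        (proj₂ (balanced-falseˡ (prefix (here refl)) zx))

  first-true : (f : V → Bool) (P : Path x y) → f x ≡ false → w ∈ verts P → f w ≡ true →
    ∃[ a ] ∃[ l ] ∃[ b ] Σ (Path x a) λ p → Σ (Adj (E l) a b) λ e → Σ (Path b y) λ q →
      P ≡ join p e q × (∀ {v} → v ∈ verts p → f v ≡ false) × f b ≡ true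
  first-true f []                   fx (here refl) fw = ⊥-elim (true≢false fw fx)
  first-true f (step l e P)         fx (here refl) fw = ⊥-elim (true≢false fw fx)
  first-true f (step {y = b} l e P) fx (there w∈)  fw with f b in fb
  ... | true  = _ , l , b , [] , e , P , refl , (λ { (here refl) → fx }) , fb
  ... | false with first-true f P fb w∈ fw
  ...   | _ , _ , _ , p , e′ , q , refl , below , fb′ =
            _ , _ , _ , step l e p , e′ , q , refl , (λ { (here refl) → fx ; (there v∈) → below v∈ }) , fb′

  source-of-join : (p : Path x a) (e : Adj (E l) a b) (q : Path b y) → w ∈ verts p →
    ∃[ m ] ∃[ d ] ((w , m , d) ∈ steps (join p e q))
  source-of-join p e q w∈ with source-or-end p w∈
  ... | inj₁ (m , d , st) = m , d , step-join⁺ˡ p e q st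
  ... | inj₂ refl         = _ , _ , step-join⁺ᵐ p e q

  target-of-join : (p : Path x a) (e : Adj (E l) a b) (q : Path b y) → w ∈ verts q →
    ∃[ c ] ∃[ m ] ((c , m , w) ∈ steps (join p e q))
  target-of-join p e q w∈ with target-or-start q w∈
  ... | inj₁ refl         = _ , _ , step-join⁺ᵐ p e q
  ... | inj₂ (c , m , st) = c , m , step-join⁺ʳ p e q st

  -- The mirror image: here the non-neighbours of `x` do not form a final segment. As `y` is one of
  -- them, some step beyond `b` leads from a neighbour of `x` to a non-neighbour; read backwards, it
  -- is the step that `returning-nested` starts from.
  returning-nested′ : {P : Path x y} (p : Path x a) (e : Adj (E l) a b) (q : Path b y) → P ≡ join p e q →
    State P i s → (c , m , z) ∈ steps p → adj (E i) x z ≡ false → adj (E i) x b ≡ true →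
    ∀ w → adj (E i) x w ≡ false → adj (E i) y w ≡ false
  returning-nested′ {x} {y} {i = i} {s} p e q refl St z∈ xz xb
    with first-true (not ∘ adj (E i) x) q (cong not xb) (end∈ q) (cong not (noClosure St))
  ... | a′ , l′ , b′ , q₁ , f , q₂ , refl , below , xb′ =
    returning-nested (rev q₂) (flipE f) (join (rev q₁) (flipE e) (rev p))
      (trans (cong rev (sym (join-assoc p e q₁ f q₂)))
        (trans (rev-join (join p e q₁) f q₂) (cong (join (rev q₂) (flipE f)) (rev-join p e q₁))))
      (reverseState St) (not-injective xb′)
      (not-injective (below (end∈ q₁)))
      (step-join⁺ʳ (rev q₁) (flipE e) (rev p) (step-rev⁺ p z∈)) xz

  -- The sources of (C3) and (C2). With `twins`, the common neighbourhood of the ends becomes X.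
  -- With `spread`, `pre` and `suf` become the two cliques and `mid` consists of the forest and the
  -- edge uv.
  data Shape {x y : V} (P : Path x y) (i : Fin (suc n)) : Set where
    twins  : (∀ w → adj (E i) x w ≡ adj (E i) y w) → Shape P i
    spread : ∀ {a l b c m d} (pre : Path x a) (e : Adj (E l) a b) (mid : Path b c) (e′ : Adj (E m) c d)
      (suf : Path d y) → P ≡ join pre e (join mid e′ suf) →
      (∀ {w} → w ∈ verts pre → adj (E i) y w ≡ false) →
      (∀ {t} → t ∈ labels mid → fixed t ≡ true) →
      (∀ {w} → w ∈ verts suf → adj (E i) x w ≡ false) → Shape P i

  fixed-run : (P : Path x y) → (∀ {t} → t ∈ labels P → fixed t ≡ true) ⊎
    (∃[ a ] ∃[ l ] ∃[ b ] Σ (Path x a) λ p → Σ (Adj (E l) a b) λ e → Σ (Path b y) λ q →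
      P ≡ join p e q × (∀ {t} → t ∈ labels p → fixed t ≡ true) × fixed l ≡ false)
  fixed-run [] = inj₁ λ ()
  fixed-run (step l e P) with fixed l in fl
  ... | false = inj₂ (_ , l , _ , [] , e , P , refl , (λ ()) , fl)
  ... | true with fixed-run P
  ...   | inj₁ all = inj₁ λ { (here refl) → fl ; (there t∈) → all t∈ }
  ...   | inj₂ (_ , _ , _ , p , e′ , q , refl , all , fl′) =
            inj₂ (_ , _ , _ , step l e p , e′ , q , refl , (λ { (here refl) → fl ; (there t∈) → all t∈ }) , fl′)

  find-true : (f : V → Bool) (xs : List V) → (∀ {w} → w ∈ xs → f w ≡ false) ⊎ (∃[ w ] (w ∈ xs × f w ≡ true))
  find-true f [] = inj₁ λ ()
  find-true f (x ∷ xs) with f x in fx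
  ... | true = inj₂ (x , here refl , fx)
  ... | false with find-true f xs
  ...   | inj₁ none         = inj₁ λ { (here refl) → fx ; (there w∈) → none w∈ }
  ...   | inj₂ (w , w∈ , fw) = inj₂ (w , there w∈ , fw)

  ≡-from-nested : {f g : V → Bool} → (∀ w → f w ≡ false → g w ≡ false) → (∀ w → g w ≡ false → f w ≡ false) →
    ∀ w → f w ≡ g w
  ≡-from-nested {f} {g} f⇒g g⇒f w with f w in fw | g w in gw
  ... | true  | true  = refl
  ... | false | false = refl
  ... | false | true  = trans (sym (f⇒g w fw)) gw
  ... | true  | false = trans (sym fw) (g⇒f w gw)

  -- A fixed step carries both adjacencies, so `y` has a neighbour; `pre` stops just before the
  -- first one. The shape depends on whether `y` later misses a source again.
  classify : {P : Path x y} → State P i s → (∃[ l ] fixed l ≡ true) → Shape P i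
  classify {x} {y} {i} {s} {P} St (l₀ , fl₀)
    with labelled-step P (fixed-used St l₀ fl₀)
  ... | a₀ , b₀ , st₀
    with first-true (adj (E i) y) P (ends-nonadjacent St) (source∈ P st₀)
           (proj₂ (balanced-fixed (tight (swap St) st₀) fl₀))
  ... | a , l , b , pre , e , suf , refl , low , yb
    with find-true (not ∘ adj (E i) y) (map sourceOf (steps suf))
  ... | inj₂ (z , z∈ , ¬yz) with ∈-map⁻ sourceOf z∈
  ...   | (_ , m , d) , z-step , refl with split suf z-step
  -- Since `y` misses `z` after having met a neighbour, everything missed by `y` is missed by `x`.
  -- In particular `x` misses `z`, while tightness at the step leaving `z` gives a neighbour of `x`
  -- right after it; so the mirror image applies too.
  ...     | splitAt s₁ e₁ s₂ refl = twins (≡-from-nested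
              (returning-nested′ (join pre e s₁) e₁ s₂ (sym (join-assoc pre e s₁ e₁ s₂)) St
                (proj₂ (proj₂ (target-of-join pre e s₁ (end∈ s₁))))
                (nested z yz)
                (proj₂ (balanced-falseʳ (tight St
                  (step-join⁺ʳ pre e _ (step-join⁺ᵐ s₁ e₁ s₂))) (trans (sym (end-agree St z)) yz))))
              nested)
    where
      yz : adj (E i) y z ≡ false
      yz = not-injective ¬yz
      nested : ∀ w → adj (E i) y w ≡ false → adj (E i) x w ≡ false
      nested = returning-nested pre e _ refl St (low (end∈ pre)) yb z-step yz
  classify {x} {y} {i} {s} St (l₀ , fl₀) | a₀ , b₀ , st₀ | a , l , b , pre , e , suf , refl , low , yb | inj₁ high
    with fixed-run suf
  -- If the whole suffix were fixed, its last step would force `x` and `y` to be adjacent.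
  ... | inj₁ all with target-or-start suf (end∈ suf)
  ...   | inj₁ refl         = ⊥-elim (true≢false yb (irrefl (E i) y))
  ...   | inj₂ (c , m , st) = ⊥-elim (true≢false
          (proj₁ (balanced-fixed (tight St (step-join⁺ʳ pre e suf st)) (all (∈-map⁺ labelOf st)))) (noClosure St))
  classify {x} {y} {i} {s} St (l₀ , fl₀) | a₀ , b₀ , st₀ | a , l , b , pre , e , suf , refl , low , yb | inj₁ high
    | inj₂ (c , m , d , mid , e′ , suf′ , refl , all , fm)
    with find-true (adj (E i) x) (verts suf′)
  ... | inj₁ none = spread pre e mid e′ suf′ refl low all none
  -- The step into `d` is free and leaves a neighbour of `y`, so `x` misses `d`. A neighbour of `x`
  -- further on would make `y` miss `d` as well, although `d` would then be a source in the part
  -- where `y` misses none.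
  ... | inj₂ (w , w∈ , xw) with first-true (adj (E i) x) suf′ xd w∈ xw
    where
      xd : adj (E i) x d ≡ false
      xd = trans (balanced-free (tight St (step-join⁺ʳ pre e _ (step-join⁺ᵐ mid e′ suf′))) fm)
        (cong not (trans (sym (end-agree St c)) (not-injective (high (∈-map⁺ sourceOf (step-join⁺ᵐ mid e′ suf′))))))
  ...   | _ , _ , _ , g₁ , e₂ , g₂ , refl , low′ , xh with source-of-join g₁ e₂ g₂ (start∈ g₁)
  ...     | _ , _ , d-step = ⊥-elim (true≢false
              (not-injective (high (∈-map⁺ sourceOf (step-join⁺ʳ mid e′ _ d-step))))
              (returning-nested′ (join (join pre e mid) e′ g₁) e₂ g₂
                (sym (trans (join-assoc (join pre e mid) e′ g₁ e₂ g₂) (join-assoc pre e mid e′ (join g₁ e₂ g₂)))) St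
                (step-join⁺ᵐ (join pre e mid) e′ g₁) (low′ (start∈ g₁)) xh d (low′ (start∈ g₁))))

  -- Whichever of the two vertices comes first on the path agrees with `x` on the other one.
  common-nonneighbours : {P : Path x y} → State P i s →
    adj (E i) x w ≡ false → adj (E i) y w ≡ false → adj (E i) x v ≡ false → adj (E i) y v ≡ false →
    adj (E i) w v ≡ false
  common-nonneighbours {i = i} {w = w} {v = v} {P = P} St xw yw xv yv with w Fin.≟ v
  ... | yes refl = irrefl (E i) w
  ... | no w≢v with Before-total P (all-verts St w) (all-verts St v) w≢v
  ...   | inj₁ bf = trans (earlier-nonneighbour St bf yw) xv
  ...   | inj₂ bf = trans (adj-sym i w v) (trans (earlier-nonneighbour St bf yv) xw)

  -- A label on the path is made spare by a rotation at its step. At a free step `y` misses the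
  -- source or `x` misses the target, so the rotation works for the path or for its reverse.
  twins-independent : {P : Path x y} → State P i s → (∀ w → adj (E i) x w ≡ adj (E i) y w) →
    ∀ t → fixed t ≡ false → ∀ w v → adj (E i) x w ≡ false → adj (E i) x v ≡ false → adj (E t) w v ≡ false
  twins-independent {x} {y} {i} {s} {P} St tw t ft w v xw xv with label-cases St t
  ... | inj₁ refl        = common-nonneighbours St xw (toy xw) xv (toy xv)
    where toy : ∀ {u} → adj (E i) x u ≡ false → adj (E i) y u ≡ false
          toy xu = trans (sym (tw _)) xu
  ... | inj₂ (inj₁ refl) = common-nonneighbours (swap St) (tosx xw) (tosy xw) (tosx xv) (tosy xv)
    where tosx : ∀ {u} → adj (E i) x u ≡ false → adj (E s) x u ≡ false
          tosx xu = trans (sym (start-agree St _)) xu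
          tosy : ∀ {u} → adj (E i) x u ≡ false → adj (E s) y u ≡ false
          tosy xu = trans (sym (end-agree St _)) (trans (sym (tw _)) xu)
  ... | inj₂ (inj₂ t∈) with labelled-step P t∈
  ...   | a , b , st = go (adj (E i) y a) refl
    where
      left : ∀ {x y a b} {P : Path x y} → State P i s → (a , t , b) ∈ steps P →
        (∀ w → adj (E i) x w ≡ adj (E i) y w) → adj (E i) y a ≡ false →
        adj (E i) x w ≡ false → adj (E i) x v ≡ false → adj (E t) w v ≡ false
      left {x} {y} {a} {P = P} St st tw ya xw xv with split P st
      ... | splitAt p e q refl =
        common-nonneighbours R (at xw) (yt xw) (at xv) (yt xv)
        where
          R = turn p e q St ya
          ys : ∀ {u} → adj (E i) x u ≡ false → adj (E s) y u ≡ false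
          ys xu = trans (sym (end-agree St _)) (trans (sym (tw _)) xu)
          xs : ∀ {u} → adj (E i) x u ≡ false → adj (E s) x u ≡ false
          xs xu = trans (sym (start-agree St _)) xu
          yt : ∀ {u} → adj (E i) x u ≡ false → adj (E t) y u ≡ false
          yt xu = trans (end-agree R _) (ys xu)
          -- The new start `a` is itself missed by both old ends, so independence in `s` already
          -- tells what it misses.
          at : ∀ {u} → adj (E i) x u ≡ false → adj (E t) a u ≡ false
          at xu = trans (start-agree R _)
            (common-nonneighbours (swap St) (xs (trans (tw a) ya)) (ys (trans (tw a) ya)) (xs xu) (ys xu))
      go : ∀ β → adj (E i) y a ≡ β → adj (E t) w v ≡ false
      go false ya = left St st tw ya xw xv
      go true  ya = left (reverseState St) (step-rev⁺ P st) (λ u → sym (tw u))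
        (trans (balanced-free (tight St st) ft) (cong not (trans (sym (end-agree St a)) ya)))
        (trans (sym (tw w)) xw) (trans (sym (tw v)) xv)

  -- The rotation makes `t` spare. It reverses `p` but keeps it ahead of `q`, so in either case of
  -- the disjunction `w` still precedes `v`.
  rotation-nonadjacent : (p : Path x a) (e : Adj (E t) a b) (q : Path b y) (St : State (join p e q) i s) →
    adj (E i) y a ≡ false → w ∈ verts p ⊎ Before q w v → adj (E i) y w ≡ false →
    v ∈ verts q → adj (E i) x v ≡ false → adj (E t) w v ≡ false
  rotation-nonadjacent {t = t} {i = i} {s} {w} {v} p e q St ya order yw v∈ xv =
    trans (earlier-nonneighbour R (new order) (trans (end-agree R w) (trans (sym (end-agree St w)) yw)))
      (trans (start-agree R v) (trans (turn-suffix p e q St ya v∈) (trans (sym (start-agree St v)) xv)))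
    where
      R = turn p e q St ya
      f = proj₂ (pivot p e q St ya)
      new : w ∈ verts p ⊎ Before q w v → Before (join (rev p) f q) w v
      new (inj₁ w∈) = Before-join (rev p) f q (∈-rev⁺ p w∈) v∈
      new (inj₂ bf) = Before-joinʳ (rev p) f bf

  -- All vertices of `pre` are missed by `y`, so a rotation is possible at every step leaving one of
  -- them. Labels of the suffix are reached through the reversed path.
  spread-left : (pre : Path x a) (e : Adj (E l) a b) (rest : Path b y) → State (join pre e rest) i s →
    (∀ {u} → u ∈ verts pre → adj (E i) y u ≡ false) → w ∈ verts pre → v ∈ verts rest → adj (E i) x v ≡ false →
    t ∈ labels pre ⊎ t ≡ l → adj (E t) w v ≡ false
  spread-left pre e rest St low w∈ v∈ xv (inj₂ refl) =
    rotation-nonadjacent pre e rest St (low (end∈ pre)) (inj₁ w∈) (low w∈) v∈ xv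
  spread-left pre e rest St low w∈ v∈ xv (inj₁ t∈) with labelled-step pre t∈
  ... | _ , _ , st with split pre st
  ...   | splitAt p e₁ q refl = rotation-nonadjacent p e₁ (join q e rest)
            (subst (λ r → State r _ _) (join-assoc p e₁ q e rest) St)
            (low (∈-join⁺ˡ p e₁ q (end∈ p)))
            (order (∈-join⁻ p e₁ q w∈)) (low w∈) (∈-join⁺ʳ q e rest v∈) xv
    where
      order : ∀ {w} → w ∈ verts p ⊎ w ∈ verts q → w ∈ verts p ⊎ Before (join q e rest) w _
      order (inj₁ w∈p) = inj₁ w∈p
      order (inj₂ w∈q) = inj₂ (Before-join q e rest w∈q v∈)

  spread-independent : (pre : Path x a) (e : Adj (E l) a b) (mid : Path b c) (e′ : Adj (E m) c d) (suf : Path d y) →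
    State (join pre e (join mid e′ suf)) i s →
    (∀ {w} → w ∈ verts pre → adj (E i) y w ≡ false) →
    (∀ {t} → t ∈ labels mid → fixed t ≡ true) →
    (∀ {w} → w ∈ verts suf → adj (E i) x w ≡ false) →
    ∀ t → fixed t ≡ false → w ∈ verts pre → v ∈ verts suf → adj (E t) w v ≡ false
  spread-independent {x} {l = l} {m = m} {y = y} {i = i} {s} {w} {v} pre e mid e′ suf St low all high t ft w∈ v∈ =
    go (label-cases St t)
    where
      bf = Before-join pre e (join mid e′ suf) w∈ (∈-join⁺ʳ mid e′ suf v∈)
      left : t ∈ labels pre ⊎ t ≡ l → adj (E t) w v ≡ false
      left = spread-left pre e _ St low w∈ (∈-join⁺ʳ mid e′ suf v∈) (high v∈)
      revP : rev (join pre e (join mid e′ suf)) ≡ join (rev suf) (flipE e′) (rev (join pre e mid))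
      revP = trans (cong rev (sym (join-assoc pre e mid e′ suf))) (rev-join (join pre e mid) e′ suf)
      right : t ∈ labels suf ⊎ t ≡ m → adj (E t) w v ≡ false
      right o = trans (adj-sym t w v) (spread-left (rev suf) (flipE e′) (rev (join pre e mid))
        (subst (λ r → State r i s) revP (reverseState St)) (λ u∈ → high (∈-rev⁻ suf u∈))
        (∈-rev⁺ suf v∈) (∈-rev⁺ (join pre e mid) (∈-join⁺ˡ pre e mid w∈)) (low w∈) (flip-label o))
        where
          flip-label : t ∈ labels suf ⊎ t ≡ m → t ∈ labels (rev suf) ⊎ t ≡ m
          flip-label (inj₁ t∈) = inj₁ (PermP.∈-resp-↭ (↭-sym (labels-rev suf)) t∈)
          flip-label (inj₂ eq) = inj₂ eq
      go : t ≡ i ⊎ t ≡ s ⊎ t ∈ labels (join pre e (join mid e′ suf)) → adj (E t) w v ≡ false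
      go (inj₁ refl) = trans (earlier-nonneighbour St bf (low w∈)) (high v∈)
      go (inj₂ (inj₁ refl)) = trans
        (earlier-nonneighbour (swap St) bf (trans (sym (end-agree St w)) (low w∈)))
        (trans (sym (start-agree St v)) (high v∈))
      go (inj₂ (inj₂ t∈)) with ∈-++⁻ (labels pre) (subst (t ∈_) (labels-join pre e _) t∈)
      ... | inj₁ t∈pre         = left (inj₁ t∈pre)
      ... | inj₂ (here eq)     = left (inj₂ eq)
      ... | inj₂ (there t∈rest) with ∈-++⁻ (labels mid) (subst (t ∈_) (labels-join mid e′ suf) t∈rest)
      ...   | inj₁ t∈mid         = ⊥-elim (true≢false (all t∈mid) ft)
      ...   | inj₂ (here eq)     = right (inj₂ eq)
      ...   | inj₂ (there t∈suf) = right (inj₁ t∈suf)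

  -- In both spare labels `y` has the neighbours that `x` has in `i`, so the lower bound `ore-ends`
  -- and the upper bound `deg-bound` concern the same number.
  twins-degree : {P : Path x y} → State P i s → (∀ w → adj (E i) x w ≡ adj (E i) y w) → 2 * deg (E i) x ≡ n + k
  twins-degree {x} {y} {i} {s} St tw = ≤-antisym
    (≤-trans (≤-reflexive (trans double (cong (deg (E i) x +_) (same s (λ w → trans (tw w) (end-agree St w)))))) (deg-bound St))
    (≤-trans (ore-ends St) (≤-reflexive (trans (cong (deg (E i) x +_) (sym (same i tw))) (sym double))))
    where
      double : 2 * deg (E i) x ≡ deg (E i) x + deg (E i) x
      double = cong (deg (E i) x +_) (+-identityʳ _)
      same : ∀ l → (∀ w → adj (E i) x w ≡ adj (E l) y w) → deg (E i) x ≡ deg (E l) y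
      same l eq = trans (deg-sum (E i) x)
        (trans (sum-map-cong (allFin n) (λ {w} _ → cong 𝟙 (eq w))) (sym (deg-sum (E l) y)))

-- Deciding whether a closed state exists, and cutting a cycle open

module Closing {n : ℕ} (E : Fin (suc n) → Graph n) (fixed : Fin (suc n) → Bool) where

  open States E fixed

  Closure : Set
  Closure = ∃[ x ] ∃[ y ] Σ (Path x y) λ P → ∃[ i ] ∃[ s ] (State P i s × Adj (E i) x y)

  -- The prescribed length makes the search finite. An edge is an equation between Booleans, so by
  -- `uip` one proof of it represents all.
  search : (m : ℕ) {x : V} (Q : ∀ {y} → Path x y → Set) → (∀ {y} (P : Path x y) → Dec (Q P)) →
    Dec (∃[ y ] Σ (Path x y) λ P → length (steps P) ≡ m × Q P)
  search zero Q Q? with Q? []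
  ... | yes q = yes (_ , [] , refl , q)
  ... | no ¬q = no λ { (_ , [] , _ , q) → ¬q q }
  search (suc m) {x} Q Q? = map′
    (λ { (b , l , e , y , P , eq , q) → y , step l e P , cong suc eq , q })
    (λ { (y , step l e P , eq , q) → _ , l , e , y , P , suc-injective eq , q })
    (FinP.any? λ b → FinP.any? λ l → first b l)
    where
      first : ∀ b l → Dec (Σ (Adj (E l) x b) λ e → ∃[ y ] Σ (Path b y) λ P → length (steps P) ≡ m × Q (step l e P))
      first b l with adj (E l) x b Bool.≟ true
      ... | no ¬e = no λ { (e , _) → ¬e e }
      ... | yes e = map′ (e ,_)
              (λ { (e′ , y , P , eq , q) → y , P , eq , subst (λ f → Q (step l f P)) (uip e′ e) q })
              (search m (λ P → Q (step l e P)) (λ P → Q? (step l e P)))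

  State? : ∀ {x y} (P : Path x y) i s → Dec (State P i s)
  State? P i s = map′ (λ { (a , b , f , g) → state a b f g }) (λ { (state a b f g) → a , b , f , g })
    (permutation? Fin._≟_ (verts P) (allFin n) ×-dec permutation? Fin._≟_ (i ∷ s ∷ labels P) (allFin (suc n))
      ×-dec (fixed i Bool.≟ false) ×-dec (fixed s Bool.≟ false))

  closure? : Dec Closure
  closure? = map′
    (λ { (x , y , P , _ , q) → x , y , P , q })
    (λ { (x , y , P , i , s , St , e) → x , y , P , cong pred (suc-length-steps St) , i , s , St , e })
    (FinP.any? λ x → search (pred n)
      (λ {y} P → ∃[ i ] ∃[ s ] (State P i s × Adj (E i) x y))
      (λ {y} P → FinP.any? λ i → FinP.any? λ s → State? P i s ×-dec (adj (E i) x y Bool.≟ true)))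

  ¬closure⇒NoClosure : ¬ Closure → NoClosure
  ¬closure⇒NoClosure ¬cl {x} {y} {i} {s} {P} St with adj (E i) x y in e
  ... | false = refl
  ... | true  = ⊥-elim (¬cl (x , y , P , i , s , St , e))

  module _ {x y a b : V} {i s l : Fin (suc n)} (p : Path x a) (e : Adj (E l) a b) (q : Path b y)
           (St : State (join p e q) i s) where

    label-once : l ∉ labels p × l ∉ labels q
    label-once = (λ l∈ → unique-++-disjoint {xs = labels p} un l∈ (here refl)) , unique-++ʳ (labels p) un
      where
        un : Unique (labels p ++ l ∷ labels q)
        un with Unique-resp-↭ (↭-sym (St .spare)) (allFin⁺ (suc n))
        ... | _ ∷ _ ∷ un = subst Unique (labels-join p e q) un

    module _ (closing : Adj (E i) x y) where

      -- The cycle with the step labelled `l` removed in place of the closing edge, so that `l`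
      -- takes over the role of `i`.
      reopen : Path b a
      reopen = join q (flipE closing) p

      reopen-span : verts reopen ↭ allFin n
      reopen-span = ↭-trans (↭-reflexive (verts-join q (flipE closing) p))
        (↭-trans (PermP.++-comm (verts q) (verts p))
          (↭-trans (↭-reflexive (sym (verts-join p e q))) (St .span)))

      reopen-spare : l ∷ s ∷ labels reopen ↭ allFin (suc n)
      reopen-spare = begin
        l ∷ s ∷ labels reopen                      ≡⟨ cong (λ z → l ∷ s ∷ z) (labels-join q (flipE closing) p) ⟩
        l ∷ s ∷ (labels q ++ i ∷ labels p)         ↭⟨ prep l (prep s (PermP.++-comm (labels q) (i ∷ labels p))) ⟩
        l ∷ s ∷ i ∷ (labels p ++ labels q)         ↭⟨ prep l (Perm.swap s i ↭-refl) ⟩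
        l ∷ i ∷ s ∷ (labels p ++ labels q)         ↭⟨ Perm.swap l i ↭-refl ⟩
        i ∷ l ∷ s ∷ (labels p ++ labels q)         ↭⟨ prep i (Perm.swap l s ↭-refl) ⟩
        i ∷ s ∷ l ∷ (labels p ++ labels q)         ↭⟨ prep i (prep s (↭-sym (PermP.shift l (labels p) (labels q)))) ⟩
        i ∷ s ∷ (labels p ++ l ∷ labels q)         ≡⟨ cong (λ z → i ∷ s ∷ z) (sym (labels-join p e q)) ⟩
        i ∷ s ∷ labels (join p e q)                ↭⟨ St .spare ⟩
        allFin (suc n)                             ∎
        where open PermutationReasoning

      reopen-avoids : l ≢ i → l ∉ labels reopen
      reopen-avoids l≢i l∈ with ∈-++⁻ (labels q) (subst (l ∈_) (labels-join q (flipE closing) p) l∈)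
      ... | inj₁ l∈q           = proj₂ label-once l∈q
      ... | inj₂ (here eq)     = l≢i eq
      ... | inj₂ (there l∈p)   = proj₁ label-once l∈p

-- Path covers

module Covers {n : ℕ} (E : Fin (suc n) → Graph n) where

  open Paths E

  private variable
    x y a b : V
    l : Fin (suc n)

  Piece : Set
  Piece = ∃[ x ] ∃[ y ] Path x y

  pverts : Piece → List V
  pverts (_ , _ , P) = verts P

  plabels : Piece → List (Fin (suc n))
  plabels (_ , _ , P) = labels P

  -- A stage between single vertices and one spanning path; `U` holds exactly the labels that are
  -- still to be placed.
  record Cover (C : List Piece) (U : List (Fin (suc n))) : Set where
    constructor cover
    field
      partitions : concatMap pverts C ↭ allFin n
      unused     : U ++ concatMap plabels C ↭ allFin (suc n)
  open Cover

  reorder : ∀ {C D U} → C ↭ D → Cover C U → Cover D U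
  reorder {U = U} p Cv = cover (↭-trans (concatMap-↭ pverts (↭-sym p)) (Cv .partitions))
    (↭-trans (PermP.++⁺ˡ U (concatMap-↭ plabels (↭-sym p))) (Cv .unused))

  turn-piece : ∀ {C U} (A : Path x y) → Cover ((x , y , A) ∷ C) U → Cover ((y , x , rev A) ∷ C) U
  turn-piece {C = C} {U} A Cv = cover
    (↭-trans (PermP.++⁺ʳ (concatMap pverts C) (verts-rev A)) (Cv .partitions))
    (↭-trans (PermP.++⁺ˡ U (PermP.++⁺ʳ (concatMap plabels C) (labels-rev A))) (Cv .unused))

  merge : ∀ {C U} (A : Path x a) (e : Adj (E l) a b) (B : Path b y) →
    Cover ((x , a , A) ∷ (b , y , B) ∷ C) (l ∷ U) → Cover ((x , y , join A e B) ∷ C) U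
  merge {l = l} {C = C} {U} A e B Cv = cover
    (↭-trans (↭-reflexive (trans (cong (_++ concatMap pverts C) (verts-join A e B)) (++-assoc (verts A) (verts B) _)))
      (Cv .partitions))
    (begin
      U ++ labels (join A e B) ++ R           ≡⟨ cong (λ z → U ++ z ++ R) (labels-join A e B) ⟩
      U ++ (labels A ++ l ∷ labels B) ++ R    ≡⟨ cong (U ++_) (++-assoc (labels A) _ R) ⟩
      U ++ labels A ++ l ∷ labels B ++ R      ≡⟨ ++-assoc U (labels A) _ ⟨
      (U ++ labels A) ++ l ∷ labels B ++ R    ↭⟨ PermP.shift l (U ++ labels A) (labels B ++ R) ⟩
      l ∷ (U ++ labels A) ++ labels B ++ R    ≡⟨ cong (l ∷_) (++-assoc U (labels A) _) ⟩
      l ∷ U ++ labels A ++ labels B ++ R      ↭⟨ Cv .unused ⟩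
      allFin (suc n)                          ∎)
    where open PermutationReasoning
          R = concatMap plabels C

  -- There are n + 1 labels for n vertices, and a piece has one vertex more than labels. A single
  -- piece thus leaves two labels, as a state requires.
  unused-length : ∀ {C U} → Cover C U → length U ≡ suc (length C)
  unused-length {C} {U} Cv = +-cancelʳ-≡ Λ (length U) (suc (length C)) (begin
    length U + Λ                               ≡⟨ length-++ U ⟨
    length (U ++ concatMap plabels C)          ≡⟨ trans (PermP.↭-length (Cv .unused)) (length-tabulate id) ⟩
    suc n                                      ≡⟨ cong suc (trans (PermP.↭-length (Cv .partitions)) (length-tabulate id)) ⟨
    suc (length (concatMap pverts C))          ≡⟨ cong suc (pieces C) ⟩
    suc (length C + Λ)                         ∎)
    where
      open ≡-Reasoning
      Λ = length (concatMap plabels C)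
      pieces : ∀ C → length (concatMap pverts C) ≡ length C + length (concatMap plabels C)
      pieces [] = refl
      pieces ((_ , _ , A) ∷ C) = begin
        length (verts A ++ concatMap pverts C)               ≡⟨ length-++ (verts A) ⟩
        length (verts A) + length (concatMap pverts C)       ≡⟨ cong₂ _+_ (trans (length-verts A) (cong suc (sym (length-map labelOf (steps A))))) (pieces C) ⟩
        suc (length (labels A)) + (length C + length (concatMap plabels C))
          ≡⟨ cong suc (trans (sym (+-assoc (length (labels A)) (length C) _))
               (trans (cong (_+ length (concatMap plabels C)) (+-comm (length (labels A)) (length C)))
                 (+-assoc (length C) _ _))) ⟩
        suc (length C + (length (labels A) + length (concatMap plabels C)))
          ≡⟨ cong (λ m → suc (length C + m)) (length-++ (labels A)) ⟨
        suc (length C + length (labels A ++ concatMap plabels C)) ∎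

  Avoids : List (Fin (suc n)) → Path x y → Set
  Avoids U A = Unique (verts A) × (∀ {m} → m ∈ labels A → m ∉ U)

  head-avoids : ∀ {C U} {A : Path x y} → Cover ((x , y , A) ∷ C) U → Avoids U A
  head-avoids {C = C} {U} {A} Cv =
    unique-++⁻ˡ (verts A) (Unique-resp-↭ (↭-sym (Cv .partitions)) (allFin⁺ n)) ,
    λ m∈ m∈U → unique-++-disjoint (Unique-resp-↭ (↭-sym (Cv .unused)) (allFin⁺ (suc n))) m∈U (∈-++⁺ˡ m∈)

  avoids-rev : ∀ {U} (A : Path x y) → Avoids U A → Avoids U (rev A)
  avoids-rev A (un , av) = Unique-resp-↭ (↭-sym (verts-rev A)) un , λ m∈ → av (PermP.∈-resp-↭ (labels-rev A) m∈)

  -- Quantifying over all simple paths that avoid `U` makes the property independent of the cover at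
  -- hand.
  EndIn : List (Fin (suc n)) → V → Set
  EndIn U a = ∀ {x y} (A : Path x y) → Avoids U A → a ∈ verts A → a ≡ x ⊎ a ≡ y

  -- Two pieces, reversed where necessary, are merged at their ends. The danger is that `a` and `b`
  -- are the two ends of one piece, where the edge would close a cycle; `apart` excludes this.
  attach : ∀ {C U l a b} → Cover C (l ∷ U) → Adj (E l) a b → EndIn (l ∷ U) a → EndIn (l ∷ U) b →
    (∀ (A : Path a b) → ¬ Avoids (l ∷ U) A) → ∃[ D ] Cover D U
  attach {C} {U} {l} {a} {b} Cv e a-end b-end apart
    with pick pverts {C} (PermP.∈-resp-↭ (↭-sym (Cv .partitions)) (∈-allFin a))
  ... | (x , y , A) , C′ , p , a∈A
    with ∈-++⁻ (verts A) (PermP.∈-resp-↭ (↭-sym (reorder p Cv .partitions)) (∈-allFin b))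
  ... | inj₁ b∈A = ⊥-elim (together A (head-avoids (reorder p Cv)) (a-end A (head-avoids (reorder p Cv)) a∈A) (b-end A (head-avoids (reorder p Cv)) b∈A))
    where
      together : ∀ {x y} (A : Path x y) → Avoids (l ∷ U) A → a ≡ x ⊎ a ≡ y → b ≡ x ⊎ b ≡ y → ⊥
      together A av (inj₁ refl) (inj₁ refl) = true≢false e (irrefl (E l) a)
      together A av (inj₁ refl) (inj₂ refl) = apart A av
      together A av (inj₂ refl) (inj₁ refl) = apart (rev A) (avoids-rev A av)
      together A av (inj₂ refl) (inj₂ refl) = true≢false e (irrefl (E l) a)
  ... | inj₂ b∈C′ with pick pverts {C′} b∈C′
  ...   | (x′ , y′ , B) , C″ , p′ , b∈B = finish A B Cv′ (a-end A (head-avoids Cv′) a∈A) (b-end B (head-avoids (reorder (Perm.swap _ _ ↭-refl) Cv′)) b∈B)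
    where
      Cv′ : Cover ((x , y , A) ∷ (x′ , y′ , B) ∷ C″) (l ∷ U)
      Cv′ = reorder (↭-trans p (prep _ p′)) Cv
      swapped : ∀ {A B : Piece} → Cover (A ∷ B ∷ C″) (l ∷ U) → Cover (B ∷ A ∷ C″) (l ∷ U)
      swapped = reorder (Perm.swap _ _ ↭-refl)
      finish : ∀ {x y x′ y′} (A : Path x y) (B : Path x′ y′) → Cover ((x , y , A) ∷ (x′ , y′ , B) ∷ C″) (l ∷ U) →
        a ≡ x ⊎ a ≡ y → b ≡ x′ ⊎ b ≡ y′ → ∃[ D ] Cover D U
      finish A B Cv (inj₁ refl) (inj₁ refl) = _ , merge (rev A) e B (turn-piece A Cv)
      finish A B Cv (inj₂ refl) (inj₁ refl) = _ , merge A e B Cv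
      finish A B Cv (inj₁ refl) (inj₂ refl) = _ , merge (rev A) e (rev B) (turn-piece A (swapped (turn-piece B (swapped Cv))))
      finish A B Cv (inj₂ refl) (inj₂ refl) = _ , merge A e (rev B) (swapped (turn-piece B (swapped Cv)))

  module _ (fixed : Fin (suc n) → Bool) (2≤n : 2 ≤ n)
           (free-complete : ∀ {l a b} → fixed l ≡ false → a ≢ b → Adj (E l) a b) where

    join-all : ∀ A C {U} → Cover (A ∷ C) U → (∀ {m} → m ∈ U → fixed m ≡ false) → Closing.Closure E fixed
    join-all (x , y , A) [] {[]} Cv free with () ← unused-length Cv
    join-all (x , y , A) [] {_ ∷ []} Cv free with () ← unused-length Cv
    join-all (x , y , A) [] {_ ∷ _ ∷ _ ∷ _} Cv free with () ← unused-length Cv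
    join-all (x , y , A) [] {i ∷ s ∷ []} Cv free =
      x , y , A , i , s , St , free-complete (free (here refl)) (States.ends-distinct E fixed 2≤n St)
      where
        St : States.State E fixed A i s
        St = States.state (↭-trans (↭-reflexive (sym (++-identityʳ (verts A)))) (Cv .partitions))
          (↭-trans (↭-reflexive (cong (λ z → i ∷ s ∷ z) (sym (++-identityʳ (labels A))))) (Cv .unused))
          (free (here refl)) (free (there (here refl)))
    join-all (x , y , A) ((x′ , y′ , B) ∷ C) {[]} Cv free with () ← unused-length Cv
    join-all (x , y , A) ((x′ , y′ , B) ∷ C) {l ∷ U} Cv free = join-all (x , y′ , join A e B) C (merge A e B Cv) (free ∘ there)
      where
        e : Adj (E l) y x′
        e = free-complete (free (here refl)) λ { refl →
          unique-++-disjoint (Unique-resp-↭ (↭-sym (Cv .partitions)) (allFin⁺ n)) (end∈ A) (∈-++⁺ˡ (start∈ B)) }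

  singletons : List Piece
  singletons = map (λ w → w , w , []) (allFin n)

  singletons-cover : ∀ {U} → U ↭ allFin (suc n) → Cover singletons U
  singletons-cover {U} p = cover
    (↭-reflexive (trans (concatMap-map pverts (λ w → w , w , []) (allFin n)) (concatMap-pure (allFin n))))
    (↭-trans (↭-reflexive (trans (cong (U ++_) (no-labels (allFin n))) (++-identityʳ U))) p)
    where
      no-labels : ∀ ws → concatMap plabels (map (λ w → w , w , []) ws) ≡ []
      no-labels []       = refl
      no-labels (w ∷ ws) = no-labels ws

-- The labelled family of the theorem

module Setup {n k : ℕ} (2≤n : 2 ≤ n)
  (G : Fin n → Graph n) (ore : ∀ i → σ₂≥ (G i) (n + k))
  (H : Graph n) (edges : numEdges H ≡ k)
  (c : RainbowColouring G H) (u v : Fin n) (u≢v : u ≢ v) where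

  InCH? : ∀ i → Dec (InCH c i)
  InCH? i = FinP.any? λ a → FinP.any? λ b → (adj H a b Bool.≟ true) ×-dec (col c a b Fin.≟ i)

  -- Label zero stands for the edge uv that closes the path, label suc i for colour i.
  fixed : Fin (suc n) → Bool
  fixed zero    = true
  fixed (suc i) = ⌊ InCH? i ⌋

  -- By `col-inj` this is at most one edge, so a path that carries the label of a colour in c(H)
  -- must contain the edge of H with that colour.
  edgeOf : Fin n → Graph n
  edgeOf i = record
    { adj    = λ a b → adj H a b ∧ ⌊ col c a b Fin.≟ i ⌋
    ; sym    = λ a b → symmetric a b
    ; irrefl = λ a → cong (_∧ _) (irrefl H a)
    }
    where
      symmetric : ∀ a b → adj H a b ∧ ⌊ col c a b Fin.≟ i ⌋ ≡ adj H b a ∧ ⌊ col c b a Fin.≟ i ⌋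
      symmetric a b with adj H a b in ab | adj H b a in ba
      ... | true  | true  = cong (λ j → ⌊ j Fin.≟ i ⌋) (col-sym c a b ab)
      ... | false | false = refl
      ... | true  | false = ⊥-elim (true≢false (trans (Graph.sym H b a) ab) ba)
      ... | false | true  = ⊥-elim (true≢false (trans (Graph.sym H a b) ba) ab)

  closingEdge : Graph n
  closingEdge = record
    { adj    = λ a b → (⌊ a Fin.≟ u ⌋ ∧ ⌊ b Fin.≟ v ⌋) ∨ (⌊ b Fin.≟ u ⌋ ∧ ⌊ a Fin.≟ v ⌋)
    ; sym    = λ a b → ∨-comm (⌊ a Fin.≟ u ⌋ ∧ ⌊ b Fin.≟ v ⌋) _
    ; irrefl = λ a → irreflexive a
    }
    where
      irreflexive : ∀ a → (⌊ a Fin.≟ u ⌋ ∧ ⌊ a Fin.≟ v ⌋) ∨ (⌊ a Fin.≟ u ⌋ ∧ ⌊ a Fin.≟ v ⌋) ≡ false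
      irreflexive a with a Fin.≟ u | a Fin.≟ v
      ... | yes refl | yes refl = ⊥-elim (u≢v refl)
      ... | yes _    | no _     = refl
      ... | no _     | _        = refl

  complete : Graph n
  complete = record
    { adj    = λ a b → not ⌊ a Fin.≟ b ⌋
    ; sym    = λ a b → cong not (symmetric a b)
    ; irrefl = λ a → cong not (true-⌊⌋ (a Fin.≟ a) refl)
    }
    where
      symmetric : ∀ (a b : Fin n) → ⌊ a Fin.≟ b ⌋ ≡ ⌊ b Fin.≟ a ⌋
      symmetric a b with a Fin.≟ b
      ... | yes refl = sym (true-⌊⌋ (a Fin.≟ a) refl)
      ... | no a≢b   = sym (false-⌊⌋ (b Fin.≟ a) (a≢b ∘ sym))

  edgeOf-adj : ∀ {i a b} → Adj (edgeOf i) a b → Adj H a b × col c a b ≡ i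
  edgeOf-adj {i} {a} {b} e with ∧-true e
  ... | ab , eq = ab , ⌊⌋-true (col c a b Fin.≟ i) eq

  adj-edgeOf : ∀ {a b} → Adj H a b → Adj (edgeOf (col c a b)) a b
  adj-edgeOf {a} {b} ab = ∧-intro ab (true-⌊⌋ (col c a b Fin.≟ col c a b) refl)

  closingEdge-adj : ∀ {a b} → Adj closingEdge a b → (a ≡ u × b ≡ v) ⊎ (b ≡ u × a ≡ v)
  closingEdge-adj {a} {b} e with ∨-true {⌊ a Fin.≟ u ⌋ ∧ ⌊ b Fin.≟ v ⌋} e
  ... | inj₁ t = inj₁ (⌊⌋-true (a Fin.≟ u) (proj₁ (∧-true t)) , ⌊⌋-true (b Fin.≟ v) (proj₂ (∧-true t)))
  ... | inj₂ t = inj₂ (⌊⌋-true (b Fin.≟ u) (proj₁ (∧-true t)) , ⌊⌋-true (a Fin.≟ v) (proj₂ (∧-true t)))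

  adj-closingEdge : Adj closingEdge u v
  adj-closingEdge = cong (_∨ (⌊ v Fin.≟ u ⌋ ∧ ⌊ u Fin.≟ v ⌋)) (∧-intro (true-⌊⌋ (u Fin.≟ u) refl) (true-⌊⌋ (v Fin.≟ v) refl))

  adj-complete : ∀ {a b} → a ≢ b → Adj complete a b
  adj-complete {a} {b} a≢b = cong not (false-⌊⌋ (a Fin.≟ b) a≢b)

  -- Colours below m carry their own graph, the other free colours the complete graph.
  family : ℕ → Fin (suc n) → Graph n
  family m zero    = closingEdge
  family m (suc i) = if ⌊ InCH? i ⌋ then edgeOf i else (if ⌊ toℕ i <? m ⌋ then G i else complete)

  family-fixed : ∀ m {i} → fixed (suc i) ≡ true → family m (suc i) ≡ edgeOf i
  family-fixed m fi rewrite fi = refl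

  family-own : ∀ {m i} → fixed (suc i) ≡ false → toℕ i < m → family m (suc i) ≡ G i
  family-own {m} {i} fi i<m rewrite fi | true-⌊⌋ (toℕ i <? m) i<m = refl

  family-complete : ∀ {m i} → fixed (suc i) ≡ false → ¬ toℕ i < m → family m (suc i) ≡ complete
  family-complete {m} {i} fi i≮m rewrite fi | false-⌊⌋ (toℕ i <? m) i≮m = refl

  -- Read contrapositively: an edge missing at any stage is missing in the given graph.
  family-⊇ : ∀ m {i a b} → fixed (suc i) ≡ false → Adj (G i) a b → Adj (family m (suc i)) a b
  family-⊇ m {i} {a} {b} fi ab = go (toℕ i <? m)
    where
      go : Dec (toℕ i < m) → Adj (family m (suc i)) a b
      go (yes i<m) = subst (λ F → Adj F a b) (sym (family-own fi i<m)) ab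
      go (no i≮m)  = subst (λ F → Adj F a b) (sym (family-complete fi i≮m))
                       (adj-complete λ { refl → true≢false ab (irrefl (G i) a) })

  family-suc : ∀ m {i} → toℕ i ≢ m → family m (suc i) ≡ family (suc m) (suc i)
  family-suc m {i} i≢m with fixed (suc i) in fi
  ... | true  = refl
  ... | false = go (toℕ i <? m)
    where
      own = λ b → if b then G i else complete
      go : Dec (toℕ i < m) → own ⌊ toℕ i <? m ⌋ ≡ own ⌊ toℕ i <? suc m ⌋
      go (yes i<m) = cong own (trans (true-⌊⌋ (toℕ i <? m) i<m) (sym (true-⌊⌋ (toℕ i <? suc m) (m≤n⇒m≤1+n i<m))))
      go (no i≮m)  = cong own (trans (false-⌊⌋ (toℕ i <? m) i≮m)
        (sym (false-⌊⌋ (toℕ i <? suc m) (λ i<1+m → i≮m (≤∧≢⇒< (≤-pred i<1+m) i≢m)))))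

  family-suc-fixed : ∀ m l → fixed l ≡ true → family m l ≡ family (suc m) l
  family-suc-fixed m zero    fl = refl
  family-suc-fixed m (suc i) fl = trans (family-fixed m fl) (sym (family-fixed (suc m) fl))

  family-ore : ∀ m l → fixed l ≡ false → σ₂≥ (family m l) (n + k)
  family-ore m (suc i) fi = go (toℕ i <? m)
    where
      go : Dec (toℕ i < m) → σ₂≥ (family m (suc i)) (n + k)
      go (yes i<m) = subst (λ F → σ₂≥ F (n + k)) (sym (family-own fi i<m)) (ore i)
      go (no i≮m)  = subst (λ F → σ₂≥ F (n + k)) (sym (family-complete fi i≮m))
                       (λ a b a≢b ¬ab → ⊥-elim (¬ab (adj-complete a≢b)))

  ordered : Fin n → Fin n → Bool
  ordered a b = ⌊ a Fin.<? b ⌋ ∧ adj H a b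

  -- Double counting of pairs of an edge and its colour: a used colour has at least one edge, listed
  -- with its smaller end first, and an edge has only one colour.
  colour-count : sum (map (𝟙 ∘ fixed ∘ suc) (allFin n)) ≤ numEdges H
  colour-count = begin
    sum (map (𝟙 ∘ fixed ∘ suc) V*)                                          ≤⟨ sum-map-mono V* (λ {i} _ → used i) ⟩
    sum (map (λ i → sum (map (λ a → sum (map (λ b → hit a b i) V*)) V*)) V*)
      ≡⟨ sum-swap (λ i a → sum (map (λ b → hit a b i) V*)) V* V* ⟩
    sum (map (λ a → sum (map (λ i → sum (map (λ b → hit a b i) V*)) V*)) V*)
      ≡⟨ sum-map-cong V* (λ {a} _ → sum-swap (λ i b → hit a b i) V* V*) ⟩
    sum (map (λ a → sum (map (λ b → sum (map (hit a b) V*)) V*)) V*)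
      ≤⟨ sum-map-mono V* (λ {a} _ → sum-map-mono V* (λ {b} _ → sum-indicator (ordered a b) (col c a b) (allFin⁺ n))) ⟩
    sum (map (λ a → sum (map (λ b → 𝟙 (ordered a b)) V*)) V*)
      ≡⟨ sum-map-cong V* (λ {a} _ → sym (card-tabulate′ (ordered a))) ⟩
    numEdges H ∎
    where
      open ≤-Reasoning
      V* = allFin n
      hit : Fin n → Fin n → Fin n → ℕ
      hit a b i = 𝟙 (ordered a b ∧ ⌊ col c a b Fin.≟ i ⌋)
      witness : ∀ {i} a b → a Fin.< b → Adj H a b → col c a b ≡ i →
        1 ≤ sum (map (λ a → sum (map (λ b → hit a b i) V*)) V*)
      witness {i} a b a<b ab eq = begin
        1                                                      ≡⟨ cong 𝟙 (∧-intro (∧-intro (true-⌊⌋ (a Fin.<? b) a<b) ab) (true-⌊⌋ (col c a b Fin.≟ i) eq)) ⟨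
        hit a b i                                              ≤⟨ ≤-sum-map (∈-allFin b) ⟩
        sum (map (λ b → hit a b i) V*)                         ≤⟨ ≤-sum-map (∈-allFin a) ⟩
        sum (map (λ a → sum (map (λ b → hit a b i) V*)) V*)    ∎
      used : ∀ i → 𝟙 (fixed (suc i)) ≤ sum (map (λ a → sum (map (λ b → hit a b i) V*)) V*)
      used i with InCH? i
      ... | no _ = z≤n
      ... | yes (a , b , ab , eq) with FinP.<-cmp a b
      ...   | tri< a<b _ _ = witness a b a<b ab eq
      ...   | tri≈ _ refl _ = ⊥-elim (true≢false ab (irrefl H a))
      ...   | tri> _ _ b<a = witness b a b<a (trans (Graph.sym H b a) ab) (trans (sym (col-sym c a b ab)) eq)

  few-fixed : sum (map (𝟙 ∘ fixed) (allFin (suc n))) ≤ suc k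
  few-fixed = s≤s (begin
    sum (map (𝟙 ∘ fixed) (List.tabulate suc))  ≡⟨ cong sum (trans (map-tabulate suc (𝟙 ∘ fixed)) (sym (map-tabulate id (𝟙 ∘ fixed ∘ suc)))) ⟩
    sum (map (𝟙 ∘ fixed ∘ suc) (allFin n))     ≤⟨ colour-count ⟩
    numEdges H                                 ≡⟨ edges ⟩
    k                                          ∎)
    where open ≤-Reasoning

  adj-H-sym : ∀ {a b} → Adj H a b → Adj H b a
  adj-H-sym {a} {b} ab = trans (Graph.sym H b a) ab

  edge-colour-fixed : ∀ {a b} → Adj H a b → fixed (suc (col c a b)) ≡ true
  edge-colour-fixed {a} {b} ab = true-⌊⌋ (InCH? _) (a , b , ab , refl)

  SomeState : ℕ → Set
  SomeState m = ∃[ x ] ∃[ y ] Σ (Paths.Path (family m) x y) λ P → ∃[ i ] ∃[ s ] (States.State (family m) fixed P i s)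

  -- Putting back the graph of one colour

  module _ (m : ℕ) (m<n : m < n) where

    open States (family m) fixed

    private
      λₘ : Fin (suc n)
      λₘ = suc (Fin.fromℕ< m<n)

    unaffected : ∀ {l} → l ≢ λₘ → family m l ≡ family (suc m) l
    unaffected {zero}  _  = refl
    unaffected {suc j} l≢ = family-suc m
      (λ { refl → l≢ (cong suc (FinP.toℕ-injective (sym (FinP.toℕ-fromℕ< m<n)))) })

    move : ∀ {x y i s} {P : Path x y} → verts P ↭ allFin n → i ∷ s ∷ labels P ↭ allFin (suc n) →
      fixed i ≡ false → fixed s ≡ false → (fixed λₘ ≡ true ⊎ λₘ ∉ labels P) → SomeState (suc m)
    move {P = P} vs sp fi fs unused with transport-path P (same unused)
      where
        same : (fixed λₘ ≡ true ⊎ λₘ ∉ labels P) → ∀ {l} → l ∈ labels P → family m l ≡ family (suc m) l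
        same unused {l} l∈ with l Fin.≟ λₘ
        same unused    l∈ | no l≢ = unaffected l≢
        same (inj₁ fx) l∈ | yes refl = family-suc-fixed m λₘ fx
        same (inj₂ l∉) l∈ | yes refl = ⊥-elim (l∉ l∈)
    ... | P′ , vs′ , ls′ = _ , _ , P′ , _ , _ , States.state (subst (_↭ _) (sym vs′) vs)
            (subst (λ z → _ ∷ _ ∷ z ↭ _) (sym ls′) sp) fi fs

    -- Only the graph of `λₘ` may change. If that label is free and lies on the path, the cycle is
    -- cut at its step. Otherwise dropping the closing edge is enough: a fixed label keeps its
    -- graph, and a label absent from the path cannot spoil it.
    advance : Closing.Closure (family m) fixed → SomeState (suc m)
    advance (x , y , P , i , s , St , closing) = go (fixed λₘ) refl (λₘ ∈? labels P)
      where
        open DecMembership (Fin._≟_ {suc n}) using (_∈?_)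
        go : ∀ β → fixed λₘ ≡ β → Dec (λₘ ∈ labels P) → SomeState (suc m)
        go true  fλ _         = move (St .span) (St .spare) (St .free-i) (St .free-s) (inj₁ fλ)
        go false fλ (no λ∉)   = move (St .span) (St .spare) (St .free-i) (St .free-s) (inj₂ λ∉)
        go false fλ (yes λ∈) with labelled-step P λ∈
        ... | a , b , st with split P st
        ...   | splitAt p e q refl = move
                  (Closing.reopen-span (family m) fixed p e q St closing)
                  (Closing.reopen-spare (family m) fixed p e q St closing)
                  fλ (St .free-s)
                  (inj₂ (Closing.reopen-avoids (family m) fixed p e q St closing λ≢i))
          where
            λ≢i : λₘ ≢ i
            λ≢i refl = Unique[x∷xs]⇒x∉xs (Unique-resp-↭ (↭-sym (St .spare)) (allFin⁺ (suc n))) (there λ∈)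

  ClosesAtEnds : (Fin (suc n) → Graph n) → Set
  ClosesAtEnds E = ∀ {a b} → Adj (E zero) a b → (a ≡ u × b ≡ v) ⊎ (b ≡ u × a ≡ v)

  ForestEdges : (Fin (suc n) → Graph n) → Set
  ForestEdges E = ∀ {t a b} → fixed (suc t) ≡ true → Adj (E (suc t)) a b → Adj H a b × col c a b ≡ t

  module Forest (E : Fin (suc n) → Graph n) where

    open Paths E

    private variable
      x y w : V

    ForestPath : Path x y → Set
    ForestPath P = ∀ {a l b} → (a , l , b) ∈ steps P → Adj H a b

    forest-connected : (P : Path x y) → ForestPath P → w ∈ verts P → Connected H x w
    forest-connected []           hp (here refl) = ε
    forest-connected (step l e P) hp (here refl) = ε
    forest-connected (step l e P) hp (there w∈)  = hp (here refl) ◅ forest-connected P (hp ∘ there) w∈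

    forest-rev : (P : Path x y) → ForestPath P → ForestPath (rev P)
    forest-rev P hp t∈ = adj-H-sym (hp (step-rev⁻ P t∈))

  -- From the two shapes to (C2) and (C3)

  module Extremal (E : Fin (suc n) → Graph n) (E-ore : ∀ l → fixed l ≡ false → σ₂≥ (E l) (n + k))
    (E-⊇ : ∀ {t a b} → fixed (suc t) ≡ false → Adj (G t) a b → Adj (E (suc t)) a b)
    (E-closing : ClosesAtEnds E) (fixed-edge : ForestEdges E) (noClosure : States.NoClosure E fixed) where

    open States E fixed
    open Core {n} {k} 2≤n E fixed few-fixed E-ore noClosure
    open Forest E

    private variable
      x y a b w z : V
      i s l : Fin (suc n)

    free-colour : ∀ {t} → ¬ InCH c t → fixed (suc t) ≡ false
    free-colour {t} ¬ch = false-⌊⌋ (InCH? t) ¬ch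

    nonadjacent-in-G : ∀ {t a b} → fixed (suc t) ≡ false → adj (E (suc t)) a b ≡ false → adj (G t) a b ≡ false
    nonadjacent-in-G ft na = false-from λ ab → true≢false (E-⊇ ft ab) na

    both-true : ∀ {p q} → 𝟙 p + 𝟙 q ≡ 2 → p ≡ true × q ≡ true
    both-true {p} {q} eq = balanced-fixed {true} {p} {q} eq refl

    -- Every fixed label occurs on the path and stands for one edge only, so the edges of H and the
    -- edge uv are all steps.
    forest-vertex-step : {P : Path x y} → State P i s → InVH H u v w →
      ∃[ a ] ∃[ l ] ∃[ b ] ((a , l , b) ∈ steps P × fixed l ≡ true × (w ≡ a ⊎ w ≡ b))
    forest-vertex-step {w = w} {P} St (inj₁ (z , wz))
      with labelled-step P (fixed-used St (suc (col c w z)) (edge-colour-fixed wz))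
    ... | a , b , st with fixed-edge (edge-colour-fixed wz) (step-adj P st)
    ...   | ab , eq with col-inj c w z a b wz ab (sym eq)
    ...     | inj₁ (refl , _) = a , _ , b , st , edge-colour-fixed wz , inj₁ refl
    ...     | inj₂ (refl , _) = a , _ , b , st , edge-colour-fixed wz , inj₂ refl
    forest-vertex-step {P = P} St (inj₂ w≡) with labelled-step P (fixed-used St zero refl)
    ... | a , b , st with E-closing (step-adj P st) | w≡
    ...   | inj₁ (refl , refl) | inj₁ refl = a , _ , b , st , refl , inj₁ refl
    ...   | inj₁ (refl , refl) | inj₂ refl = a , _ , b , st , refl , inj₂ refl
    ...   | inj₂ (refl , refl) | inj₁ refl = a , _ , b , st , refl , inj₂ refl
    ...   | inj₂ (refl , refl) | inj₂ refl = a , _ , b , st , refl , inj₁ refl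

    ∣complement∣ : {d : ℕ} → 2 * d ≡ n + k → 2 * (n ∸ d) ≡ n ∸ k
    ∣complement∣ {d} eq = begin
      2 * (n ∸ d)          ≡⟨ *-distribˡ-∸ 2 n d ⟩
      2 * n ∸ 2 * d        ≡⟨ cong₂ _∸_ (cong (n +_) (+-identityʳ n)) eq ⟩
      (n + n) ∸ (n + k)    ≡⟨ [m+n]∸[m+o]≡n∸o n n k ⟩
      n ∸ k                ∎
      where open ≡-Reasoning

    -- Tightness at the fixed steps puts V(H) into the common neighbourhood X. Vertices outside X
    -- are independent in each free colour, so their neighbours all lie in X; two of them have
    -- degree sum at least n + k, which is twice the size of X, so each is joined to all of X.
    twins⇒C3 : {P : Path x y} → State P i s → (∀ w → adj (E i) x w ≡ adj (E i) y w) → C3 G H c u v k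
    twins⇒C3 {x} {y} {i} {s} {P} St tw =
      nbhd (E i) x , twins-degree St tw , ∣complement∣ {deg (E i) x} (twins-degree St tw) ,
      (λ w wH → ∈-tabulate⁺ (forest-inside wH)) ,
      λ t ¬ch → (λ a b a∈ b∉ → trans (Graph.sym (G t) a b) (joined (free-colour ¬ch) b a (∉-tabulate⁻ b∉) (∈-tabulate⁻ a∈))) ,
                (λ a b a∉ b∉ ab → true≢false ab (independent (free-colour ¬ch) a b (∉-tabulate⁻ a∉) (∉-tabulate⁻ b∉)))
      where
        forest-inside : ∀ {w} → InVH H u v w → adj (E i) x w ≡ true
        forest-inside wH with forest-vertex-step St wH
        ... | a , l , b , st , fl , inj₂ refl = proj₁ (balanced-fixed (tight St st) fl)
        ... | a , l , b , st , fl , inj₁ refl =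
              trans (tw a) (proj₂ (balanced-fixed (tight (swap St) st) fl))
        independent : ∀ {t} → fixed (suc t) ≡ false → ∀ a b → adj (E i) x a ≡ false → adj (E i) x b ≡ false →
          adj (G t) a b ≡ false
        independent ft a b xa xb = nonadjacent-in-G ft (twins-independent St tw (suc _) ft a b xa xb)
        joined : ∀ {t} → fixed (suc t) ≡ false → ∀ a b → adj (E i) x a ≡ false → adj (E i) x b ≡ true → adj (G t) a b ≡ true
        joined {t} ft a b xa xb = with-partner (a Fin.≟ x)
          where
            dominated : ∀ {r} → adj (E i) x r ≡ false → ∀ w → 𝟙 (adj (G t) r w) ≤ 𝟙 (adj (E i) x w)
            dominated {r} xr w with adj (E i) x w in xw
            ... | true  = 𝟙≤1 _
            ... | false rewrite independent ft r w xr xw = z≤n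
            partner : ∀ a′ → a ≢ a′ → adj (E i) x a′ ≡ false → adj (G t) a b ≡ true
            partner a′ a≢a′ xa′ = proj₁ (both-true (trans
              (sum-map-tight (allFin n) (λ {w} _ → +-mono-≤ (dominated xa w) (dominated xa′ w)) enough (∈-allFin b))
              (cong (λ β → 𝟙 β + 𝟙 β) xb)))
              where
                open ≤-Reasoning
                f = 𝟙 ∘ adj (E i) x
                enough : sum (map (λ w → f w + f w) (allFin n)) ≤
                         sum (map (λ w → 𝟙 (adj (G t) a w) + 𝟙 (adj (G t) a′ w)) (allFin n))
                enough = begin
                  sum (map (λ w → f w + f w) (allFin n))            ≡⟨ sum-map-+ f f (allFin n) ⟩
                  sum (map f (allFin n)) + sum (map f (allFin n))   ≡⟨ cong₂ _+_ (deg-sum (E i) x) (deg-sum (E i) x) ⟨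
                  deg (E i) x + deg (E i) x                         ≡⟨ cong (deg (E i) x +_) (+-identityʳ _) ⟨
                  2 * deg (E i) x                                   ≡⟨ twins-degree St tw ⟩
                  n + k                                             ≤⟨ ore t a a′ a≢a′ (λ e → true≢false e (independent ft a a′ xa xa′)) ⟩
                  deg (G t) a + deg (G t) a′                        ≡⟨ cong₂ _+_ (deg-sum (G t) a) (deg-sum (G t) a′) ⟩
                  sum (map (𝟙 ∘ adj (G t) a) (allFin n)) + sum (map (𝟙 ∘ adj (G t) a′) (allFin n))
                                                                    ≡⟨ sum-map-+ (𝟙 ∘ adj (G t) a) (𝟙 ∘ adj (G t) a′) (allFin n) ⟨
                  sum (map (λ w → 𝟙 (adj (G t) a w) + 𝟙 (adj (G t) a′ w)) (allFin n)) ∎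
            -- The degree condition needs a second vertex outside X: the end `x`, or `y` when `a` is
            -- `x`.
            with-partner : Dec (a ≡ x) → adj (G t) a b ≡ true
            with-partner (yes refl) = partner y (ends-distinct 2≤n St) (noClosure St)
            with-partner (no a≢x)   = partner x a≢x (irrefl (E i) x)

    fixed-forest : (P : Path x y) → (∀ {t} → t ∈ labels P → fixed t ≡ true) → zero ∉ labels P → ForestPath P
    fixed-forest P all 0∉ {a} {zero}  {b} st = ⊥-elim (0∉ (∈-map⁺ labelOf st))
    fixed-forest P all 0∉ {a} {suc t} {b} st = proj₁ (fixed-edge (all (∈-map⁺ labelOf st)) (step-adj P st))

    module Spread {x y a b a′ b′ : V} {i s l l′ : Fin (suc n)}
      (pre : Path x a) (e : Adj (E l) a b) (mid : Path b a′) (e′ : Adj (E l′) a′ b′) (suf : Path b′ y)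
      (St : State (join pre e (join mid e′ suf)) i s)
      (low  : ∀ {w} → w ∈ verts pre → adj (E i) y w ≡ false)
      (all  : ∀ {t} → t ∈ labels mid → fixed t ≡ true)
      (high : ∀ {w} → w ∈ verts suf → adj (E i) x w ≡ false) where

      private
        P = join pre e (join mid e′ suf)

      verts-P : verts P ≡ verts pre ++ verts mid ++ verts suf
      verts-P = trans (verts-join pre e (join mid e′ suf)) (cong (verts pre ++_) (verts-join mid e′ suf))

      from-low : ∀ {a t b} → (a , t , b) ∈ steps P → adj (E i) y a ≡ false → fixed t ≡ false
      from-low st ya = proj₁ (balanced-falseʳ (tight (swap St) st) ya)

      to-high : ∀ {a t b} → (a , t , b) ∈ steps P → adj (E i) x b ≡ false → fixed t ≡ false
      to-high st xb = proj₁ (balanced-falseˡ (tight St st) xb)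

      -- A fixed step leaves a neighbour of `y` and enters a neighbour of `x`. The first fails up to
      -- the step into `mid`, the second from the step out of `mid` onwards.
      fixed-step-mid : ∀ {a t b} → (a , t , b) ∈ steps P → fixed t ≡ true → (a , t , b) ∈ steps mid
      fixed-step-mid st ft with step-join⁻ pre e (join mid e′ suf) st
      ... | inj₁ st-pre      = ⊥-elim (true≢false ft (from-low st (low (source∈ pre st-pre))))
      ... | inj₂ (inj₁ refl) = ⊥-elim (true≢false ft (from-low st (low (end∈ pre))))
      ... | inj₂ (inj₂ st′) with step-join⁻ mid e′ suf st′
      ...   | inj₁ st-mid        = st-mid
      ...   | inj₂ (inj₁ refl)   = ⊥-elim (true≢false ft (to-high st (high (start∈ suf))))
      ...   | inj₂ (inj₂ st-suf) = ⊥-elim (true≢false ft (to-high st (high (target∈ suf st-suf))))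

      forest⊆mid : ∀ {w} → InVH H u v w → w ∈ verts mid
      forest⊆mid wH with forest-vertex-step St wH
      ... | _ , _ , _ , st , ft , inj₁ refl = source∈ mid (fixed-step-mid st ft)
      ... | _ , _ , _ , st , ft , inj₂ refl = target∈ mid (fixed-step-mid st ft)

      private
        EndsAt : V → V → Set
        EndsAt p q = (p ≡ u × q ≡ v) ⊎ (q ≡ u × p ≡ v)

      -- The step for uv lies in `mid` and its label occurs only once. Removing it leaves two runs
      -- of edges of H, one attached to `u` and one to `v`; hence H has no other components.
      mid⊆forest : ∀ {w} → w ∈ verts mid → InVH H u v w × (Connected H u w ⊎ Connected H v w)
      mid⊆forest {w} w∈ with labelled-step P (fixed-used St zero refl)
      ... | p , q , st with split mid (fixed-step-mid st refl)
      ...   | splitAt m₁ e₀ m₂ refl = go (∈-join⁻ m₁ e₀ m₂ w∈) (E-closing (step-adj P st))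
        where
          once = Closing.label-once E fixed (join pre e m₁) e₀ (join m₂ e′ suf)
            (subst (λ r → State r i s)
              (trans (cong (join pre e) (join-assoc m₁ e₀ m₂ e′ suf)) (sym (join-assoc pre e m₁ e₀ (join m₂ e′ suf)))) St)
          forest₁ : ForestPath m₁
          forest₁ = fixed-forest m₁ (λ t∈ → all (subst (_ ∈_) (sym (labels-join m₁ e₀ m₂)) (∈-++⁺ˡ t∈)))
            (λ 0∈ → proj₁ once (subst (_ ∈_) (sym (labels-join pre e m₁)) (∈-++⁺ʳ (labels pre) (there 0∈))))
          forest₂ : ForestPath m₂
          forest₂ = fixed-forest m₂ (λ t∈ → all (subst (_ ∈_) (sym (labels-join m₁ e₀ m₂)) (∈-++⁺ʳ (labels m₁) (there t∈))))
            (λ 0∈ → proj₂ once (subst (_ ∈_) (sym (labels-join m₂ e′ suf)) (∈-++⁺ˡ 0∈)))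
          end-inside : ∀ {r} → (r ≡ u ⊎ r ≡ v) → Connected H r w → Connected H u w ⊎ Connected H v w
          end-inside (inj₁ refl) = inj₁
          end-inside (inj₂ refl) = inj₂
          left-end : EndsAt p q → p ≡ u ⊎ p ≡ v
          left-end (inj₁ (pu , _)) = inj₁ pu
          left-end (inj₂ (_ , pv)) = inj₂ pv
          right-end : EndsAt p q → q ≡ u ⊎ q ≡ v
          right-end (inj₁ (_ , qv)) = inj₂ qv
          right-end (inj₂ (qu , _)) = inj₁ qu
          go : w ∈ verts m₁ ⊎ w ∈ verts m₂ → EndsAt p q → InVH H u v w × (Connected H u w ⊎ Connected H v w)
          go (inj₁ w∈₁) at = inVH (source-or-end m₁ w∈₁) ,
            end-inside (left-end at) (forest-connected (rev m₁) (forest-rev m₁ forest₁) (∈-rev⁺ m₁ w∈₁))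
            where
              inVH : (∃[ t ] ∃[ r ] ((w , t , r) ∈ steps m₁)) ⊎ w ≡ p → InVH H u v w
              inVH (inj₁ (_ , r , st)) = inj₁ (r , forest₁ st)
              inVH (inj₂ refl)         = inj₂ (left-end at)
          go (inj₂ w∈₂) at = inVH (target-or-start m₂ w∈₂) ,
            end-inside (right-end at) (forest-connected m₂ forest₂ w∈₂)
            where
              inVH : w ≡ q ⊎ ∃[ r ] ∃[ t ] ((r , t , w) ∈ steps m₂) → InVH H u v w
              inVH (inj₂ (r , _ , st)) = inj₁ (r , adj-H-sym (forest₂ st))
              inVH (inj₁ refl)         = inj₂ (right-end at)

      independent : ∀ {t} → fixed (suc t) ≡ false → ∀ {w z} → w ∈ verts pre → z ∈ verts suf → adj (G t) w z ≡ false
      independent ft w∈ z∈ = nonadjacent-in-G ft (spread-independent pre e mid e′ suf St low all high _ ft w∈ z∈)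

      -- All its labels are fixed, at most k + 1 of them, and there is one vertex more.
      length-mid : length (verts mid) ≤ suc (suc k)
      length-mid = begin
        length (verts mid)                          ≡⟨ length-verts mid ⟩
        suc (length (steps mid))                    ≡⟨ cong suc (length-map labelOf (steps mid)) ⟨
        suc (length (labels mid))                   ≡⟨ cong suc (trans (sum-map-const 1 (labels mid)) (*-identityʳ _)) ⟨
        suc (sum (map (λ _ → 1) (labels mid)))      ≡⟨ cong suc (sum-map-cong (labels mid) (λ t∈ → cong 𝟙 (all t∈))) ⟨
        suc (Σfixed (labels mid))                   ≤⟨ s≤s (≤-trans (m≤m+n _ _) (≤-reflexive (sym (Σfixed-++ (labels mid) _)))) ⟩
        suc (Σfixed (labels mid ++ l′ ∷ labels suf)) ≡⟨ cong (suc ∘ Σfixed) (labels-join mid e′ suf) ⟨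
        suc (Σfixed (labels (join mid e′ suf)))     ≤⟨ s≤s (≤-trans (m≤n+m _ (𝟙 (fixed l))) (≤-trans (m≤n+m _ (Σfixed (labels pre))) (≤-reflexive (sym (Σfixed-++ (labels pre) _))))) ⟩
        suc (Σfixed (labels pre ++ l ∷ labels (join mid e′ suf))) ≡⟨ cong (suc ∘ Σfixed) (labels-join pre e _) ⟨
        suc (Σfixed (labels P))                     ≤⟨ s≤s (few-fixed-steps St) ⟩
        suc (suc k)                                 ∎
        where
          open ≤-Reasoning
          Σfixed : List (Fin (suc n)) → ℕ
          Σfixed ls = sum (map (𝟙 ∘ fixed) ls)
          Σfixed-++ : ∀ ls ms → Σfixed (ls ++ ms) ≡ Σfixed ls + Σfixed ms
          Σfixed-++ ls ms = trans (cong sum (map-++ (𝟙 ∘ fixed) ls ms)) (sum-++ (map (𝟙 ∘ fixed) ls) _)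

      -- The three blocks of the path, tagged so that they can be given different capacities.
      blocks : List (Fin 3 × V)
      blocks = map (Fin.zero ,_) (verts pre) ++ map (Fin.suc zero ,_) (verts mid) ++ map (Fin.suc (Fin.suc zero) ,_) (verts suf)

      sum-blocks : (f : Fin 3 × V → ℕ) → sum (map f blocks) ≡
        sum (map (λ r → f (Fin.zero , r)) (verts pre)) + (sum (map (λ r → f (Fin.suc zero , r)) (verts mid)) +
          sum (map (λ r → f (Fin.suc (Fin.suc zero) , r)) (verts suf)))
      sum-blocks f = trans (trans (cong sum (map-++ f (map (_ ,_) (verts pre)) _)) (sum-++ (map f (map (_ ,_) (verts pre))) _))
        (cong₂ _+_ (cong sum (sym (map-∘ (verts pre))))
          (trans (trans (cong sum (map-++ f (map (_ ,_) (verts mid)) _)) (sum-++ (map f (map (_ ,_) (verts mid))) _))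
            (cong₂ _+_ (cong sum (sym (map-∘ (verts mid)))) (cong sum (sym (map-∘ (verts suf)))))))

      deg-blocks : ∀ F w → deg F w ≡ sum (map (𝟙 ∘ adj F w ∘ proj₂) blocks)
      deg-blocks F w = begin
        deg F w                                            ≡⟨ deg-sum F w ⟩
        sum (map f (allFin n))                             ≡⟨ sum-↭ (PermP.map⁺ f (St .span)) ⟨
        sum (map f (verts P))                              ≡⟨ cong (sum ∘ map f) verts-P ⟩
        sum (map f (verts pre ++ verts mid ++ verts suf))  ≡⟨ trans (cong sum (map-++ f (verts pre) _)) (sum-++ (map f (verts pre)) _) ⟩
        sum (map f (verts pre)) + sum (map f (verts mid ++ verts suf))
                                                           ≡⟨ cong (sum (map f (verts pre)) +_) (trans (cong sum (map-++ f (verts mid) _)) (sum-++ (map f (verts mid)) _)) ⟩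
        sum (map f (verts pre)) + (sum (map f (verts mid)) + sum (map f (verts suf)))
                                                           ≡⟨ sum-blocks (f ∘ proj₂) ⟨
        sum (map (f ∘ proj₂) blocks)                       ∎
        where open ≡-Reasoning
              f = 𝟙 ∘ adj F w

      module _ {t : Fin n} (ft : fixed (suc t) ≡ false) {w z : V} (w∈ : w ∈ verts pre) (z∈ : z ∈ verts suf) where

        private
          -- An upper bound on what a vertex adds to the degree sum of `w` and `z`. No edges run
          -- between `pre` and `suf`, so only vertices of `mid` can count twice, and `w` and `z` do
          -- not count themselves.
          room : Fin 3 × V → ℕ
          room (zero , r)           = 𝟙 (not ⌊ r Fin.≟ w ⌋)
          room (suc zero , r)       = 2
          room (suc (suc zero) , r) = 𝟙 (not ⌊ r Fin.≟ z ⌋)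

          joint : Fin 3 × V → ℕ
          joint (_ , r) = 𝟙 (adj (G t) w r) + 𝟙 (adj (G t) z r)

          z-pre : ∀ {r} → r ∈ verts pre → adj (G t) z r ≡ false
          z-pre r∈ = trans (Graph.sym (G t) z _) (independent ft r∈ z∈)

          avoid : ∀ r w → 𝟙 (adj (G t) w r) ≤ 𝟙 (not ⌊ r Fin.≟ w ⌋)
          avoid r w with r Fin.≟ w
          ... | no _     = 𝟙≤1 _
          ... | yes refl = ≤-reflexive (cong 𝟙 (irrefl (G t) r))

          joint≤room : ∀ {r} → r ∈ blocks → joint r ≤ room r
          joint≤room r∈ with ∈-++⁻ (map (Fin.zero ,_) (verts pre)) r∈
          ... | inj₁ r∈pre with ∈-map⁻ (Fin.zero ,_) r∈pre
          ...   | r , r∈′ , refl rewrite z-pre r∈′ = ≤-trans (≤-reflexive (+-identityʳ _)) (avoid r w)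
          joint≤room r∈ | inj₂ r∈′ with ∈-++⁻ (map (Fin.suc zero ,_) (verts mid)) r∈′
          ... | inj₁ r∈mid with ∈-map⁻ (Fin.suc zero ,_) r∈mid
          ...   | r , _ , refl = +-mono-≤ (𝟙≤1 (adj (G t) w r)) (𝟙≤1 (adj (G t) z r))
          joint≤room r∈ | inj₂ r∈′ | inj₂ r∈suf with ∈-map⁻ (Fin.suc (Fin.suc zero) ,_) r∈suf
          ...   | r , r∈″ , refl rewrite independent ft w∈ r∈″ = avoid r z

          w≢z : w ≢ z
          w≢z refl = unique-++-disjoint {xs = verts pre} (subst Unique verts-P (unique-verts St)) w∈ (∈-++⁺ʳ (verts mid) z∈)

          enough : sum (map room blocks) ≤ sum (map joint blocks)
          enough = begin
            sum (map room blocks)   ≤⟨ +-cancelˡ-≤ 2 _ _ budget ⟩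
            n + k                   ≤⟨ ore t w z w≢z (λ wz → true≢false wz (independent ft w∈ z∈)) ⟩
            deg (G t) w + deg (G t) z ≡⟨ cong₂ _+_ (deg-blocks (G t) w) (deg-blocks (G t) z) ⟩
            _                       ≡⟨ sum-map-+ (𝟙 ∘ adj (G t) w ∘ proj₂) (𝟙 ∘ adj (G t) z ∘ proj₂) blocks ⟨
            sum (map joint blocks)  ∎
            where
              open ≤-Reasoning
              A = sum (map (λ r → 𝟙 (not ⌊ r Fin.≟ w ⌋)) (verts pre))
              B = length (verts mid)
              C = sum (map (λ r → 𝟙 (not ⌊ r Fin.≟ z ⌋)) (verts suf))
              size : length (verts pre) + (B + length (verts suf)) ≡ n
              size = begin-equality
                length (verts pre) + (B + length (verts suf))     ≡⟨ cong (length (verts pre) +_) (length-++ (verts mid)) ⟨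
                length (verts pre) + length (verts mid ++ verts suf) ≡⟨ length-++ (verts pre) ⟨
                length (verts pre ++ verts mid ++ verts suf)      ≡⟨ cong length verts-P ⟨
                length (verts P)                                  ≡⟨ PermP.↭-length (St .span) ⟩
                length (allFin n)                                 ≡⟨ length-tabulate id ⟩
                n                                                 ∎
              -- The room is (|pre| - 1) + 2|mid| + (|suf| - 1), that is n + |mid| - 2, and |mid| is
              -- at most k + 2. Adding 2 on both sides avoids subtraction.
              budget : 2 + sum (map room blocks) ≤ 2 + (n + k)
              budget = begin
                2 + sum (map room blocks)                                 ≡⟨ cong (2 +_) (sum-blocks room) ⟩
                2 + (A + (sum (map (λ _ → 2) (verts mid)) + C))           ≡⟨ cong (λ m → 2 + (A + (m + C))) (sum-map-const 2 (verts mid)) ⟩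
                2 + (A + (B * 2 + C))                                     ≡⟨ solve 3 (λ a b c → con 2 :+ (a :+ (b :* con 2 :+ c)) := ((con 1 :+ a) :+ (b :+ (con 1 :+ c))) :+ b) refl A B C ⟩
                (suc A + (B + suc C)) + B                                 ≤⟨ +-mono-≤ (+-mono-≤ (sum-others w∈) (+-monoʳ-≤ B (sum-others z∈))) length-mid ⟩
                (length (verts pre) + (B + length (verts suf))) + (2 + k) ≡⟨ cong (_+ (2 + k)) size ⟩
                n + (2 + k)                                               ≡⟨ solve 2 (λ a b → a :+ (con 2 :+ b) := con 2 :+ (a :+ b)) refl n k ⟩
                2 + (n + k)                                               ∎
                where open +-*-Solver

          full : ∀ {r} → r ∈ blocks → joint r ≡ room r
          full = sum-map-tight blocks joint≤room enough

          in-pre : ∀ {r} → r ∈ verts pre → (Fin.zero , r) ∈ blocks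
          in-pre r∈ = ∈-++⁺ˡ (∈-map⁺ _ r∈)
          in-mid : ∀ {r} → r ∈ verts mid → (Fin.suc Fin.zero , r) ∈ blocks
          in-mid r∈ = ∈-++⁺ʳ (map (Fin.zero ,_) (verts pre)) (∈-++⁺ˡ (∈-map⁺ _ r∈))
          in-suf : ∀ {r} → r ∈ verts suf → (Fin.suc (Fin.suc Fin.zero) , r) ∈ blocks
          in-suf r∈ = ∈-++⁺ʳ (map (Fin.zero ,_) (verts pre)) (∈-++⁺ʳ (map (Fin.suc zero ,_) (verts mid)) (∈-map⁺ _ r∈))

        pre-clique : ∀ {r} → r ∈ verts pre → w ≢ r → adj (G t) w r ≡ true
        pre-clique {r} r∈ w≢r = 𝟙-injective (trans (sym (trans (cong (λ β → 𝟙 (adj (G t) w r) + 𝟙 β) (z-pre r∈)) (+-identityʳ _)))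
          (trans (full (in-pre r∈)) (cong (𝟙 ∘ not) (false-⌊⌋ (r Fin.≟ w) (w≢r ∘ sym)))))

        suf-clique : ∀ {r} → r ∈ verts suf → z ≢ r → adj (G t) z r ≡ true
        suf-clique {r} r∈ z≢r = 𝟙-injective (trans (sym (cong (λ β → 𝟙 β + 𝟙 (adj (G t) z r)) (independent ft w∈ r∈)))
          (trans (full (in-suf r∈)) (cong (𝟙 ∘ not) (false-⌊⌋ (r Fin.≟ z) (z≢r ∘ sym)))))

        mid-joined : ∀ {r} → r ∈ verts mid → adj (G t) w r ≡ true × adj (G t) z r ≡ true
        mid-joined r∈ = both-true (full (in-mid r∈))

      outside : ∀ {w} → ¬ InVH H u v w → w ∈ verts pre ⊎ w ∈ verts suf
      outside {w} ¬wH with ∈-join⁻ pre e (join mid e′ suf) (all-verts St w)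
      ... | inj₁ w∈ = inj₁ w∈
      ... | inj₂ w∈′ with ∈-join⁻ mid e′ suf w∈′
      ...   | inj₁ w∈ = ⊥-elim (¬wH (proj₁ (mid⊆forest w∈)))
      ...   | inj₂ w∈ = inj₂ w∈

      open DecMembership (Fin._≟_ {n}) using (_∈?_)

      conclusion : C2 G H c u v
      conclusion = (λ w wH → proj₂ (mid⊆forest (forest⊆mid wH))) , X ,
        (x , (λ xH → pre≢ (start∈ pre) (∈-++⁺ˡ (forest⊆mid xH))) , ∈-tabulate⁺ (true-⌊⌋ (x ∈? verts pre) (start∈ pre))) ,
        (y , (λ yH → disjoint-mid-suf (forest⊆mid yH) (end∈ suf)) ,
          λ y∈X → pre≢ (inX y∈X) (∈-++⁺ʳ (verts mid) (end∈ suf))) ,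
        λ t ¬ch → let ft = free-colour ¬ch in
          (λ w w′ _ _ w∈ w′∈ w≢ → pre-clique ft (inX w∈) (end∈ suf) (inX w′∈) w≢) ,
          (λ z z′ ¬z ¬z′ z∉ z′∉ z≢ → suf-clique ft (start∈ pre) (notX ¬z z∉) (notX ¬z′ z′∉) z≢) ,
          (λ w z _ ¬z w∈ z∉ wz → true≢false wz (independent ft (inX w∈) (notX ¬z z∉))) ,
          (λ w z wH ¬z → trans (Graph.sym (G t) w z) (cross ft (forest⊆mid wH) (outside ¬z)))
        where
          -- The complement of this subset contains V(H) besides `suf`, which is why `notX` asks for
          -- a vertex outside V(H).
          X = tabulate (λ w → ⌊ w ∈? verts pre ⌋)
          unique-P : Unique (verts pre ++ verts mid ++ verts suf)
          unique-P = subst Unique verts-P (unique-verts St)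
          pre≢ : ∀ {w} → w ∈ verts pre → w ∉ verts mid ++ verts suf
          pre≢ = unique-++-disjoint unique-P
          disjoint-mid-suf : ∀ {w} → w ∈ verts mid → w ∉ verts suf
          disjoint-mid-suf = unique-++-disjoint (unique-++⁻ʳ (verts pre) unique-P)
          inX : ∀ {w} → w Sub.∈ X → w ∈ verts pre
          inX {w} w∈ = ⌊⌋-true (w ∈? verts pre) (∈-tabulate⁻ w∈)
          notX : ∀ {w} → ¬ InVH H u v w → w Sub.∉ X → w ∈ verts suf
          notX {w} ¬wH w∉ with outside ¬wH
          ... | inj₁ w∈ = ⊥-elim (w∉ (∈-tabulate⁺ (true-⌊⌋ (w ∈? verts pre) w∈)))
          ... | inj₂ w∈ = w∈
          cross : ∀ {t} → fixed (suc t) ≡ false → ∀ {w z} → w ∈ verts mid → z ∈ verts pre ⊎ z ∈ verts suf → adj (G t) z w ≡ true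
          cross ft w∈ (inj₁ z∈) = proj₁ (mid-joined ft z∈ (end∈ suf) w∈)
          cross ft w∈ (inj₂ z∈) = proj₂ (mid-joined ft (start∈ pre) z∈ w∈)

    extremal : {P : Path x y} → State P i s → C2 G H c u v ⊎ C3 G H c u v k
    extremal St with classify St (zero , refl)
    ... | twins tw = inj₂ (twins⇒C3 St tw)
    ... | spread pre e mid e′ suf refl low all high = inj₁ (Spread.conclusion pre e mid e′ suf St low all high)

  -- Reading a rainbow Hamiltonian path off the cycle

  module HamPath (E : Fin (suc n) → Graph n) (E-⊆ : ∀ {t a b} → Adj (E (suc t)) a b → Adj (G t) a b)
    (E-closing : ClosesAtEnds E) (fixed-edge : ForestEdges E) where

    open States E fixed

    module _ (Q : Path u v) {s : Fin (suc n)} (vs : verts Q ↭ allFin n)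
             (ls : zero ∷ s ∷ labels Q ↭ allFin (suc n)) (free-s : fixed s ≡ false) where

      private
        unique-vs : Unique (verts Q)
        unique-vs = Unique-resp-↭ (↭-sym vs) (allFin⁺ n)

        unique-ls : Unique (zero ∷ s ∷ labels Q)
        unique-ls = Unique-resp-↭ (↭-sym ls) (allFin⁺ (suc n))

        length-vs : suc (length (steps Q)) ≡ n
        length-vs = trans (sym (length-verts Q)) (trans (PermP.↭-length vs) (length-tabulate id))

        colour : Fin (suc n) → Fin n
        -- A dummy value: label zero is spare and does not occur on `Q`.
        colour zero    = u
        colour (suc t) = t

        vertexAt : ℕ → V
        vertexAt = nth u (verts Q)

        labelAt : ℕ → Fin (suc n)
        labelAt = nth zero (labels Q)

        within : ∀ {m} → suc m < n → m < length (steps Q)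
        within {m} lt = ≤-pred (≤-trans lt (≤-reflexive (sym length-vs)))

        position< : ∀ (i : Fin n) → toℕ i < length (verts Q)
        position< i = ≤-trans (FinP.toℕ<n i) (≤-reflexive (trans (sym length-vs) (sym (length-verts Q))))

        next< : ∀ {i j : Fin n} → Next i j → toℕ i < length (steps Q)
        next< {i} {j} ij = within (subst (_< n) ij (FinP.toℕ<n j))

        labels-nonzero : ∀ {l} → l ∈ labels Q → ∃[ t ] l ≡ suc t
        labels-nonzero {zero}  0∈ = ⊥-elim (Unique[x∷xs]⇒x∉xs unique-ls (there 0∈))
        labels-nonzero {suc t} _  = t , refl

        labelAt-colour : ∀ {m} → m < length (steps Q) → labelAt m ≡ suc (colour (labelAt m))
        labelAt-colour m< with labels-nonzero (nth-∈ zero (labels Q) (≤-trans m< (≤-reflexive (sym (length-map labelOf (steps Q))))))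
        ... | t , eq = trans eq (cong suc (cong colour (sym eq)))

        edge-at : ∀ {m} → m < length (steps Q) → Adj (E (suc (colour (labelAt m)))) (vertexAt m) (vertexAt (suc m))
        edge-at {m} m< = subst (λ l → Adj (E l) (vertexAt m) (vertexAt (suc m))) (labelAt-colour m<)
          (step-adj Q (nth-step u zero Q m<))

        forest-label : ∀ {a b} → Adj H a b → suc (col c a b) ∈ labels Q
        forest-label {a} {b} ab with PermP.∈-resp-↭ (↭-sym ls) (∈-allFin (suc (col c a b)))
        ... | there (here refl) = ⊥-elim (true≢false (edge-colour-fixed ab) free-s)
        ... | there (there l∈)  = l∈

        forest-position : ∀ {a b} → Adj H a b → ∃[ m ] (m < length (steps Q) ×
          SameEdge a b (vertexAt m) (vertexAt (suc m)) × labelAt m ≡ suc (col c a b))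
        forest-position {a} {b} ab with labelled-step Q (forest-label ab)
        ... | p , q , st with step-nth u zero Q st
        ...   | m , m< , refl , eq , refl with fixed-edge (edge-colour-fixed ab) (step-adj Q st)
        ...     | pq , ceq = m , m< , col-inj c a b _ _ ab pq (sym ceq) , eq

        vertexAt-injective : ∀ {m m′} → m < n → m′ < n → vertexAt m ≡ vertexAt m′ → m ≡ m′
        vertexAt-injective m< m′< = nth-injective u unique-vs (bound m<) (bound m′<)
          where bound : ∀ {m} → m < n → m < length (verts Q)
                bound lt = ≤-trans lt (≤-reflexive (trans (sym length-vs) (sym (length-verts Q))))

        step< : ∀ {m} → m < length (steps Q) → suc m < n
        step< m< = ≤-trans (s≤s m<) (≤-reflexive length-vs)

      rainbowHamPath : RainbowHamPath G H c u v
      rainbowHamPath = record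
        { p        = vertexAt ∘ toℕ
        ; p-inj    = λ i j eq → FinP.toℕ-injective (nth-injective u unique-vs (position< i) (position< j) eq)
        ; p-start  = λ i i≡0 → trans (cong vertexAt i≡0) (nth-start u Q)
        ; p-end    = λ i i≡ → trans (cong vertexAt (trans i≡ (cong (_∸ 1) (sym length-vs)))) (nth-end u Q)
        ; contains = λ a b ab → position-indices (forest-position ab)
        ; c'       = colour ∘ labelAt ∘ toℕ
        ; c'-ok    = λ i j ij → subst (λ m → Adj (G (colour (labelAt (toℕ i)))) (vertexAt (toℕ i)) (vertexAt m)) (sym ij) (E-⊆ (edge-at (next< {i} {j} ij)))
        ; c'-inj   = λ i j i′ j′ ij ij′ eq → FinP.toℕ-injective (labelAt-injective (next< {i} {j} ij) (next< {i′} {j′} ij′) eq)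
        ; c'-ext   = λ i j ij ab → extends i j ij (forest-position ab)
        }
        where
          position-indices : ∀ {a b} → ∃[ m ] (m < length (steps Q) × SameEdge a b (vertexAt m) (vertexAt (suc m)) × labelAt m ≡ suc (col c a b)) →
            ∃[ i ] ∃[ j ] (Next i j × SameEdge a b (vertexAt (toℕ i)) (vertexAt (toℕ j)))
          position-indices {a} {b} (m , m< , same , _) = Fin.fromℕ< m<n , Fin.fromℕ< 1+m<n ,
            trans toj (cong suc (sym toi)) ,
            subst (λ r → SameEdge a b (vertexAt r) (vertexAt (toℕ (Fin.fromℕ< 1+m<n)))) (sym toi)
              (subst (λ r → SameEdge a b (vertexAt m) (vertexAt r)) (sym toj) same)
            where
              1+m<n = step< m<
              m<n   = <-trans (n<1+n m) 1+m<n
              toi   = FinP.toℕ-fromℕ< m<n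
              toj   = FinP.toℕ-fromℕ< 1+m<n
          labelAt-injective : ∀ {m m′} → m < length (steps Q) → m′ < length (steps Q) →
            colour (labelAt m) ≡ colour (labelAt m′) → m ≡ m′
          labelAt-injective m< m′< eq with unique-ls
          ... | _ ∷ _ ∷ un = nth-injective zero un (bound m<) (bound m′<)
                  (trans (labelAt-colour m<) (trans (cong suc eq) (sym (labelAt-colour m′<))))
            where bound : ∀ {m} → m < length (steps Q) → m < length (labels Q)
                  bound lt = ≤-trans lt (≤-reflexive (sym (length-map labelOf (steps Q))))
          extends : ∀ i j → Next i j → ∃[ m ] (m < length (steps Q) ×
              SameEdge (vertexAt (toℕ i)) (vertexAt (toℕ j)) (vertexAt m) (vertexAt (suc m)) ×
              labelAt m ≡ suc (col c (vertexAt (toℕ i)) (vertexAt (toℕ j)))) →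
            colour (labelAt (toℕ i)) ≡ col c (vertexAt (toℕ i)) (vertexAt (toℕ j))
          extends i j ij (m , m< , inj₁ (eq , _) , lab) =
            cong colour (trans (cong labelAt (vertexAt-injective (FinP.toℕ<n i) (<-trans (n<1+n m) (step< m<)) eq)) lab)
          -- Matching the edge in reverse would place `i` at m + 1 and its successor `j` at m.
          extends i j ij (m , m< , inj₂ (eqᵢ , eqⱼ) , lab) = ⊥-elim (1+n≰n (≤-trans (n≤1+n (suc m)) (≤-reflexive absurd)))
            where
              absurd : suc (suc m) ≡ m
              absurd = trans (cong suc (sym (vertexAt-injective (FinP.toℕ<n i) (step< m<) eqᵢ)))
                (trans (sym ij) (vertexAt-injective (FinP.toℕ<n j) (<-trans (n<1+n m) (step< m<)) eqⱼ))

    -- Cutting the cycle at label zero removes the edge uv, leaving a spanning path between `u` and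
    -- `v` whose labels are all colours.
    cycle⇒HamPath : Closing.Closure E fixed → RainbowHamPath G H c u v
    cycle⇒HamPath (x , y , P , i , s , St , closing) with labelled-step P (fixed-used St zero refl)
    ... | a , b , st with split P st
    ...   | splitAt p e q refl = orient (E-closing e) (Closing.reopen E fixed p e q St closing)
              (Closing.reopen-span E fixed p e q St closing) (Closing.reopen-spare E fixed p e q St closing)
      where
        orient : (a ≡ u × b ≡ v) ⊎ (b ≡ u × a ≡ v) → (Q : Path b a) → verts Q ↭ allFin n →
          zero ∷ s ∷ labels Q ↭ allFin (suc n) → RainbowHamPath G H c u v
        orient (inj₂ (refl , refl)) Q vs ls = rainbowHamPath Q vs ls (St .free-s)
        orient (inj₁ (refl , refl)) Q vs ls = rainbowHamPath (rev Q) (↭-trans (verts-rev Q) vs)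
          (↭-trans (prep zero (prep s (labels-rev Q))) ls) (St .free-s)

  -- The initial cycle, with complete graphs in the free colours

  module Base (linear : IsLinearForest H) (compatible : Compatible H u v)
    (E : Fin (suc n) → Graph n) (closing-adj : Adj (E zero) u v)
    (forest-adj : ∀ {a b} → Adj H a b → Adj (E (suc (col c a b))) a b)
    (free-complete : ∀ {l a b} → fixed l ≡ false → a ≢ b → Adj (E l) a b) (fixed-edge : ForestEdges E) where

    open Paths E
    open Covers E
    open Cover
    open Forest E

    private variable
      x y a b : V

    -- Everything outside `U` is a colour of H, label zero being excluded; so a path that avoids `U`
    -- is a path in H.
    Exhausts : List (Fin (suc n)) → Set
    Exhausts U = ∀ m → m ∈ U ⊎ (∃[ t ] (m ≡ suc t × fixed (suc t) ≡ true))

    forest-step : ∀ {U} → Exhausts U → (A : Path x y) → Avoids U A → ∀ {p m q} → (p , m , q) ∈ steps A →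
      Adj H p q × m ≡ suc (col c p q)
    forest-step ex A (_ , av) {p} {m} {q} st with ex m
    ... | inj₁ m∈ = ⊥-elim (av (∈-map⁺ labelOf st) m∈)
    ... | inj₂ (t , refl , ft) with fixed-edge ft (step-adj A st)
    ...   | pq , refl = pq , refl

    distinct-sides : (A : Path x y) → Unique (verts A) → ∀ {p m w m′ q} →
      (p , m , w) ∈ steps A → (w , m′ , q) ∈ steps A → p ≢ q
    distinct-sides A un {p} {m} {w} st st′ refl with split A st
    ... | splitAt A₁ e A₂ refl with ∈-++⁻ (steps A₁) (subst (_ ∈_) (steps-join A₁ e A₂) st′)
    ...   | inj₁ st₁           = unique-++-disjoint (subst Unique (verts-join A₁ e A₂) un) (source∈ A₁ st₁) (start∈ A₂)
    ...   | inj₂ (here refl)   = true≢false e (irrefl (E m) p)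
    ...   | inj₂ (there st₂)   = unique-++-disjoint (subst Unique (verts-join A₁ e A₂) un) (end∈ A₁) (target∈ A₂ st₂)

    end-or-interior : (A : Path x y) → a ∈ verts A →
      (a ≡ x ⊎ a ≡ y) ⊎ (∃[ p ] ∃[ m ] ∃[ m′ ] ∃[ q ] ((p , m , a) ∈ steps A × (a , m′ , q) ∈ steps A))
    end-or-interior A a∈ with target-or-start A a∈ | source-or-end A a∈
    ... | inj₁ eq           | _                   = inj₁ (inj₁ eq)
    ... | inj₂ _            | inj₂ eq             = inj₁ (inj₂ eq)
    ... | inj₂ (p , m , st) | inj₁ (m′ , q , st′) = inj₂ (p , m , m′ , q , st , st′)

    end-of-degree-one : ∀ {U} → Exhausts U → deg H a ≤ 1 → EndIn U a
    end-of-degree-one {a} ex d A av a∈ with end-or-interior A a∈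
    ... | inj₁ end = end
    ... | inj₂ (p , m , m′ , q , st , st′) = ⊥-elim (1+n≰n (≤-trans
            (deg-count H a {p ∷ q ∷ []} ((distinct-sides A (proj₁ av) st st′ ∷ []) ∷ [] ∷ [])
              λ { (here refl) → adj-H-sym (proj₁ (forest-step ex A av st))
                ; (there (here refl)) → proj₁ (forest-step ex A av st′) }) d))

    end-of-forest-edge : ∀ {l U} → Exhausts (l ∷ U) → Adj H a b → suc (col c a b) ≡ l → EndIn (l ∷ U) a
    end-of-forest-edge {a} {b} ex ab refl A av a∈ with end-or-interior A a∈
    ... | inj₁ end = end
    ... | inj₂ (p , m , m′ , q , st , st′) with forest-step ex A av st | forest-step ex A av st′
    ...   | pa , refl | aq , refl = ⊥-elim (1+n≰n (≤-trans
            (deg-count H a {p ∷ q ∷ b ∷ []}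
              ((distinct-sides A (proj₁ av) st st′ ∷ p≢b ∷ []) ∷ (q≢b ∷ []) ∷ [] ∷ [])
              λ { (here refl) → adj-H-sym pa ; (there (here refl)) → aq ; (there (there (here refl))) → ab })
            (proj₂ linear a)))
      where
        p≢b : p ≢ b
        p≢b refl = proj₂ av (∈-map⁺ labelOf st) (here (cong suc (col-sym c p a pa)))
        q≢b : q ≢ b
        q≢b refl = proj₂ av (∈-map⁺ labelOf st′) (here refl)

    forest-linked : (A : Path x y) {z : V} → (∀ {p m q} → (p , m , q) ∈ steps A → Adj H p q) → Adj H y z →
      Linked H (verts A ++ z ∷ [])
    forest-linked []                          hp yz = yz , _
    forest-linked (step l e [])               hp yz = hp (here refl) , yz , _
    forest-linked (step l e A@(step _ _ _))   hp yz = hp (here refl) , forest-linked A (hp ∘ there) yz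

    -- Such a path runs in H and does not use the edge between `a` and `b`, whose label it avoids.
    -- Together they would form a cycle of H.
    forest-edge-apart : ∀ {l U} → Exhausts (l ∷ U) → Adj H a b → suc (col c a b) ≡ l →
      (A : Path a b) → ¬ Avoids (l ∷ U) A
    forest-edge-apart ex ab refl [] av = true≢false ab (irrefl H _)
    forest-edge-apart ex ab refl A@(step m f []) av with forest-step ex A av (here refl)
    ... | _ , refl = proj₂ av (here refl) (here refl)
    forest-edge-apart {a} ex ab refl A@(step {y = d} m f (step {y = d′} m′ f′ A′)) av =
      proj₁ linear (a , d ∷ verts A′ , proj₁ av , s≤s (nonempty A′) ,
        forest-linked A (λ st → proj₁ (forest-step ex A av st)) (adj-H-sym ab))
      where
        nonempty : ∀ {x y} (B : Path x y) → 1 ≤ length (verts B)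
        nonempty B = subst (1 ≤_) (sym (length-verts B)) (s≤s z≤n)

    insert-forest : ∀ Fs {U C} → Cover C (map suc Fs ++ U) → (∀ {t} → t ∈ Fs → fixed (suc t) ≡ true) →
      Exhausts U → ∃[ D ] Cover D U
    insert-forest [] Cv fx ex = _ , Cv
    insert-forest (t ∷ Fs) {U} Cv fx ex with ⌊⌋-true (InCH? t) (fx (here refl))
    ... | a , b , ab , refl with attach Cv (forest-adj ab)
            (end-of-forest-edge ex′ ab refl)
            (end-of-forest-edge ex′ (adj-H-sym ab) (cong suc (col-sym c b a (adj-H-sym ab))))
            (forest-edge-apart ex′ ab refl)
      where
        ex′ : Exhausts (suc t ∷ map suc Fs ++ U)
        ex′ m with ex m
        ... | inj₁ m∈ = inj₁ (there (∈-++⁺ʳ (map suc Fs) m∈))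
        ... | inj₂ fm = inj₂ fm
    ...   | D , Cv′ = insert-forest Fs Cv′ (fx ∘ there) ex

    exhausts-rest : ∀ {Fs Fr} → allFin n ↭ Fs ++ Fr → (∀ {t} → t ∈ Fs → fixed (suc t) ≡ true) →
      Exhausts (zero ∷ map suc Fr)
    exhausts-rest p fx zero = inj₁ (here refl)
    exhausts-rest {Fs} p fx (suc t) with ∈-++⁻ Fs (PermP.∈-resp-↭ p (∈-allFin t))
    ... | inj₁ t∈ = inj₂ (t , refl , fx t∈)
    ... | inj₂ t∈ = inj₁ (there (∈-map⁺ suc t∈))

    base : Closing.Closure E fixed
    base with bipartition (fixed ∘ suc) (allFin n)
    ... | Fs , Fr , p , fx , fr
      with insert-forest Fs (singletons-cover start) fx (exhausts-rest p fx)
      where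
        start : map suc Fs ++ zero ∷ map suc Fr ↭ allFin (suc n)
        start = ↭-trans (PermP.shift zero (map suc Fs) (map suc Fr))
          (prep zero (↭-trans (↭-reflexive (sym (map-++ suc Fs Fr)))
            (↭-trans (PermP.map⁺ suc (↭-sym p)) (↭-reflexive (map-tabulate id suc)))))
    -- The edge uv is inserted when exactly the forest colours have been placed. The pieces are then
    -- paths in H, and compatibility says that `u` and `v` are ends of different ones.
    ... | D , Cv with attach Cv closing-adj (end-of-degree-one (exhausts-rest p fx) (proj₁ compatible))
            (end-of-degree-one (exhausts-rest p fx) (proj₁ (proj₂ compatible)))
            (λ A av → proj₂ (proj₂ compatible)
              (forest-connected A (λ st → proj₁ (forest-step (exhausts-rest p fx) A av st)) (end∈ A)))
    ...   | [] , Cv′ = ⊥-elim (1+n≰n (≤-trans (≤-trans (s≤s z≤n) 2≤n)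
              (≤-reflexive (trans (sym (length-tabulate id)) (sym (PermP.↭-length (Cv′ .partitions)))))))
    ...   | A ∷ D′ , Cv′ = join-all fixed 2≤n free-complete A D′ Cv′ free
      where
        free : ∀ {m} → m ∈ map suc Fr → fixed m ≡ false
        free m∈ with ∈-map⁻ suc m∈
        ... | t , t∈ , refl = fr t∈

  -- Induction over the colours put back

  family-forest-edges : ∀ m → ForestEdges (family m)
  family-forest-edges m {t} {a} {b} ft e = edgeOf-adj (subst (λ F → Adj F a b) (family-fixed m ft) e)

  family-⊆ : ∀ {t a b} → Adj (family n (suc t)) a b → Adj (G t) a b
  family-⊆ {t} {a} {b} e = go (fixed (suc t)) refl
    where
      go : ∀ β → fixed (suc t) ≡ β → Adj (G t) a b
      go false ft = subst (λ F → Adj F a b) (family-own ft (FinP.toℕ<n t)) e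
      go true  ft with family-forest-edges n ft e
      ... | ab , refl = col-ok c a b ab

  -- The core argument applies at the first stage without a cycle: the previous stage still supplies
  -- a state through `advance`, and the failed search supplies `NoClosure`.
  closure-or-extremal : IsLinearForest H → Compatible H u v → ∀ m → m ≤ n →
    Closing.Closure (family m) fixed ⊎ C2 G H c u v ⊎ C3 G H c u v k
  closure-or-extremal linear compatible zero _ = inj₁ (Base.base linear compatible (family 0)
    adj-closingEdge forest-adj (λ {l} {a} {b} → free-complete {l} {a} {b}) (family-forest-edges 0))
    where
      forest-adj : ∀ {a b} → Adj H a b → Adj (family 0 (suc (col c a b))) a b
      forest-adj {a} {b} ab = subst (λ F → Adj F a b) (sym (family-fixed 0 (edge-colour-fixed ab))) (adj-edgeOf ab)
      free-complete : ∀ {l a b} → fixed l ≡ false → a ≢ b → Adj (family 0 l) a b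
      free-complete {suc t} {a} {b} ft a≢b = subst (λ F → Adj F a b) (sym (family-complete {0} {t} ft λ ())) (adj-complete a≢b)
  closure-or-extremal linear compatible (suc m) m<n with closure-or-extremal linear compatible m (<⇒≤ m<n)
  ... | inj₂ ex = inj₂ ex
  ... | inj₁ cl with advance m m<n cl | Closing.closure? (family (suc m)) fixed
  ...   | _                       | yes cl′ = inj₁ cl′
  ...   | _ , _ , _ , _ , _ , St | no ¬cl  = inj₂ (Extremal.extremal (family (suc m)) (family-ore (suc m))
            (λ {t} {a} {b} → family-⊇ (suc m) {t} {a} {b}) (λ {a} {b} → closingEdge-adj {a} {b})
            (family-forest-edges (suc m)) (Closing.¬closure⇒NoClosure (family (suc m)) fixed ¬cl) St)

  path-or-extremal : IsLinearForest H → Compatible H u v →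
    RainbowHamPath G H c u v ⊎ C2 G H c u v ⊎ C3 G H c u v k
  path-or-extremal linear compatible with closure-or-extremal linear compatible n ≤-refl
  ... | inj₂ ex = inj₂ ex
  ... | inj₁ cl = inj₁ (HamPath.cycle⇒HamPath (family n) family-⊆ (λ {a} {b} → closingEdge-adj {a} {b})
          (family-forest-edges n) cl)

theorem1p8 : (k n : ℕ) → 3 * k + 4 ≤ n →
    (G : Fin n → Graph n) → (∀ i → σ₂≥ (G i) (n + k)) →
    (H : Graph n) → IsLinearForest H → numEdges H ≡ k →
    (c : RainbowColouring G H) →
    (u v : Fin n) → Compatible H u v →
    RainbowHamPath G H c u v ⊎ C2 G H c u v ⊎ C3 G H c u v k
theorem1p8 k n 3k+4≤n G ore H linear edges c u v compatible =
  Setup.path-or-extremal 2≤n G ore H edges c u v u≢v linear compatible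
  where
    2≤n : 2 ≤ n
    2≤n = ≤-trans (≤-trans (s≤s (s≤s z≤n)) (m≤n+m 4 (3 * k))) 3k+4≤n
    u≢v : u ≢ v
    u≢v refl = proj₂ (proj₂ compatible) ε
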